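{- Let $\Gamma$ be a Neumaier graph on $v$ vertices with valency $k$, in which any two adjacent vertices have exactly $\lambda$ common neighbours, and let $s$ and $e$ be as defined in the context. If every clique of $\Gamma$ of order $e+1$ is contained in a clique of order $s+1$, then $\Gamma$ is strongly regular.
   Context: A graph is edge-regular if it is regular and any two adjacent vertices have the same number $\lambda$ of common neighbours. A clique $C$ in a regular graph is a regular clique if every vertex outside $C$ is adjacent to the same positive number of vertices of $C$. A Neumaier graph is a non-complete edge-regular graph containing a regular clique. For a non-complete edge-regular graph $\Gamma$ on $v$ vertices with valency $k\ge 1$ and parameter $\lambda$: if $\Gamma$ is a complete multipartite graph, $s+1$ denotes its number of parts; otherwise $$s:=\frac{ -(k^2-k+\lambda-v\lambda)+\sqrt{(k^2-k+\lambda-v\lambda)^2+4k(v-k-1)(v+\lambda-2k)}}{2(v+\lambda-2k)}.$$ Further $e:=\frac{(s+1)(k-s)}{v-(s+1)}$. (For a Neumaier graph the regular cliques have exactly $s+1$ vertices and every vertex outside such a clique is adjacent to exactly $e$ of its vertices.) -}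

module Defs where

open import Data.Nat as ℕ using (ℕ; suc; _≥_)
open import Data.Integer as Z using (ℤ; +_; 0ℤ)
open import Data.Fin using (Fin)
open import Data.Fin.Subset using (Subset; _∈_; _∉_; _⊆_; ∣_∣)
open import Data.Fin.Subset.Properties using (_∈?_)
open import Data.List using (List; length; filter)
open import Data.List.Base using (allFin)
open import Data.Product using (Σ; ∃; ∃-syntax; _×_; _,_)
open import Data.Sum using (_⊎_)
open import Function.Definitions using (Surjective)
open import Relation.Binary.PropositionalEquality using (_≡_; _≢_)
open import Relation.Nullary using (¬_; Dec)
open import Relation.Nullary.Decidable using (_×-dec_)
open import Relation.Unary using (Decidable)
open import Function.Bundles using (_⇔_)

record Graph (v : ℕ) : Set₁ where
  field
    Adj    : Fin v → Fin v → Set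
    adj?   : (x y : Fin v) → Dec (Adj x y)
    sym    : ∀ {x y} → Adj x y → Adj y x
    irrefl : ∀ {x} → ¬ Adj x x

module _ {v : ℕ} (G : Graph v) where
  open Graph G

  countV : {P : Fin v → Set} → ((y : Fin v) → Dec (P y)) → ℕ
  countV P? = length (filter P? (allFin v))

  degree : Fin v → ℕ
  degree x = countV (adj? x)

  commonNbrs : Fin v → Fin v → ℕ
  commonNbrs x y = countV (λ z → adj? x z ×-dec adj? y z)

  IsRegular : ℕ → Set
  IsRegular k = ∀ x → degree x ≡ k

  IsEdgeRegular : ℕ → ℕ → Set
  IsEdgeRegular k λ' = IsRegular k × (∀ x y → Adj x y → commonNbrs x y ≡ λ')

  IsComplete : Set
  IsComplete = ∀ x y → x ≢ y → Adj x y

  IsClique : Subset v → Set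
  IsClique C = ∀ x y → x ∈ C → y ∈ C → x ≢ y → Adj x y

  nbrsIn : Fin v → Subset v → ℕ
  nbrsIn x C = countV (λ y → (y ∈? C) ×-dec adj? x y)

  IsRegularClique : Subset v → Set
  IsRegularClique C =
    IsClique C × Σ ℕ (λ m → m ≥ 1 × (∀ x → x ∉ C → nbrsIn x C ≡ m))

  IsNeumaier : ℕ → ℕ → Set
  IsNeumaier k λ' = ¬ IsComplete × IsEdgeRegular k λ' × ∃[ C ] IsRegularClique C

  IsCompleteMultipartiteWith : ℕ → Set
  IsCompleteMultipartiteWith n =
    Σ (Fin v → Fin n) λ p → Surjective _≡_ _≡_ p ×
      (∀ x y → x ≢ y → (Adj x y ⇔ (p x ≢ p y)))

  IsCompleteMultipartite : Set
  IsCompleteMultipartite = ∃[ n ] IsCompleteMultipartiteWith n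

  IsStronglyRegular : Set
  IsStronglyRegular = Σ ℕ λ k → Σ ℕ λ λ' → Σ ℕ λ μ →
    IsRegular k × (∀ x y → Adj x y → commonNbrs x y ≡ λ') ×
    (∀ x y → x ≢ y → ¬ Adj x y → commonNbrs x y ≡ μ)

-- Coefficients of the quadratic whose root is s:
--   s = (-b + √D) / (2a), a = v+λ-2k, b = k²-k+λ-vλ, D = b² + 4k(v-k-1)(v+λ-2k)
module _ (v k λ' : ℕ) where
  open Z using (_+_; _-_; _*_)
  coefA : ℤ
  coefA = (+ v + + λ') - + 2 * + k
  coefB : ℤ
  coefB = ((+ k * + k - + k) + + λ') - + v * + λ'
  discr : ℤ
  discr = coefB * coefB + + 4 * + k * (+ v - + k - + 1) * (+ v + + λ' - + 2 * + k)

-- "s is the parameter s of the paper" for the graph G.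
-- Non-multipartite case: s = (-b + √D)/(2a) with a ≠ 0, written out as
-- √D = 2as + b, i.e. 2as + b ≥ 0 and (2as + b)² = D.
IsParamS : {v : ℕ} → Graph v → ℕ → ℕ → ℕ → Set
IsParamS {v} G k λ' s =
  IsCompleteMultipartiteWith G (suc s)
  ⊎ (¬ IsCompleteMultipartite G × coefA v k λ' ≢ 0ℤ ×
     0ℤ Z.≤ t × t Z.* t ≡ discr v k λ')
  where
  t : ℤ
  t = (+ 2 Z.* coefA v k λ' Z.* + s) Z.+ coefB v k λ'

IsParamE : ℕ → ℕ → ℕ → ℕ → Set
IsParamE v k s e =
  (+ v Z.- + suc s) ≢ 0ℤ ×
  (+ e Z.* (+ v Z.- + suc s) ≡ + suc s Z.* (+ k Z.- + s))

{-# OPTIONS --safe #-}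
module Submission where

open import Defs
open import Data.Bool using (if_then_else_)
open import Data.Fin as Fin using (Fin; zero)
open import Data.Fin.Properties using (_≟_; all?; any?)
open import Data.Fin.Subset as Subset using (Subset; inside; outside; _⊆_; ∣_∣)
open import Data.Fin.Subset.Properties using (_∈?_; ⊆-antisym)
open import Data.Integer as ℤ using (ℤ; +_; -[1+_]; 0ℤ; 1ℤ; -1ℤ; _+_; _-_; _*_; -_; _≤_; +≤+)
open import Data.Integer.Properties hiding (_≟_)
open import Data.Integer.Tactic.RingSolver using (solve-∀)
open import Data.List using (List; []; _∷_; length; filter; map; _++_; tabulate; allFin)
open import Data.List.Membership.Propositional using (_∈_)
open import Data.List.Membership.Propositional.Properties
import Data.List.Relation.Unary.All as All
open import Data.List.Relation.Unary.AllPairs using ([]; _∷_)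
open import Data.List.Relation.Unary.Any using (here; there)
open import Data.List.Relation.Unary.Unique.Propositional using (Unique)
import Data.List.Relation.Unary.Unique.Propositional.Properties as Unique
open import Data.Nat as ℕ using (ℕ; suc; _≥_; z≤n)
import Data.Nat.Properties as ℕₚ
open import Data.Product using (Σ; ∃-syntax; _×_; _,_; proj₁; proj₂)
open import Data.Sum using (_⊎_; inj₁; inj₂; [_,_]′)
open import Data.Vec as Vec using ([]; _∷_)
import Data.Vec.Properties as Vec
open import Function using (_∘_; id)
open import Function.Bundles using (Equivalence)
open import Relation.Binary.PropositionalEquality
  using (_≡_; _≢_; refl; sym; trans; cong; cong₂; subst; subst₂; module ≡-Reasoning)
open import Relation.Nullary using (¬_; Dec; yes; no; does; contradiction)
open import Relation.Nullary.Decidable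
  using (_×-dec_; _⊎-dec_; _→-dec_; ¬?; decidable-stable; toSum)
open ≡-Reasoning

-- In a complete multipartite graph non-adjacent vertices have the same k neighbours. Otherwise call
-- the cliques of order s + 1 blocks. For a clique D, the sum of (|N(x) ∩ D| - m)² over x ∉ D depends
-- only on |D| and m, so every block has the nexus e of the given regular clique, whose order s + 1 is
-- read off from a quadratic. Hence two blocks meet in at most e vertices, and an (e+1)-clique lies in
-- exactly one block.
-- Let c(x), c(x,y) count the blocks through x and through x, y. If x, y are distinct, non-adjacent
-- and both adjacent to z, then c(x,z) = c(y,z): match each block D through x, z with the block
-- through y and D ∩ N(y). So for fixed z the level sets of c(z,·) on N(z) are unions of components
-- of the complement of Γ(z), and each block through z meets all of them in the same proportion
-- σ / M, where σ = s + 1 - e and M = k - 1 - λ + σ. Thus c(z,w) M = c(z) σ for every edge zw.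
-- Counting, for non-adjacent x, y, the common neighbours inside the blocks through x gives
-- |N(x) ∩ N(y)| σ = e M.

private variable
  A B P Q : Set

-- Integers

0≤-* : ∀ {a b} → 0ℤ ≤ a → 0ℤ ≤ b → 0ℤ ≤ a * b
0≤-* {+ m} {+ n} _ _ = subst (0ℤ ≤_) (pos-* m n) (+≤+ z≤n)

0≤-square : ∀ a → 0ℤ ≤ a * a
0≤-square (+ n)    = 0≤-* {+ n} (+≤+ z≤n) (+≤+ z≤n)
0≤-square -[1+ n ] = +≤+ z≤n

0≤∧0≤∧+≡0⇒≡0 : ∀ {a b} → 0ℤ ≤ a → 0ℤ ≤ b → a + b ≡ 0ℤ → a ≡ 0ℤ × b ≡ 0ℤ
0≤∧0≤∧+≡0⇒≡0 {+ ℕ.zero} {+ n} _ _ eq = refl , trans (sym (+-identityˡ (+ n))) eq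

*-cancelˡ-≢0 : ∀ a {b c} → a ≢ 0ℤ → a * b ≡ a * c → b ≡ c
*-cancelˡ-≢0 a {b} {c} a≢0 eq
  with i*j≡0⇒i≡0∨j≡0 a {b - c} (trans (lem a b c) (i≡j⇒i-j≡0 eq))
  where
  lem : ∀ a b c → a * (b - c) ≡ a * b - a * c
  lem = solve-∀
... | inj₁ a≡0   = contradiction a≡0 a≢0
... | inj₂ b-c≡0 = i-j≡0⇒i≡j b c b-c≡0

-- Indicators and finite sums

χ : Dec P → ℤ
χ p = if does p then 1ℤ else 0ℤ

χ-yes : (p : Dec P) → P → χ p ≡ 1ℤ
χ-yes (yes _) _ = refl
χ-yes (no ¬p) p = contradiction p ¬p

χ-no : (p : Dec P) → ¬ P → χ p ≡ 0ℤ
χ-no (yes p) ¬p = contradiction p ¬p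
χ-no (no _)  _  = refl

χ≢0⇒ : (p : Dec P) → χ p ≢ 0ℤ → P
χ≢0⇒ (yes p) _   = p
χ≢0⇒ (no _)  ≢0 = contradiction refl ≢0

0≤χ : (p : Dec P) → 0ℤ ≤ χ p
0≤χ (yes _) = +≤+ z≤n
0≤χ (no _)  = +≤+ z≤n

χ-⇔ : (p : Dec P) (q : Dec Q) → (P → Q) → (Q → P) → χ p ≡ χ q
χ-⇔ (yes p) q f g = sym (χ-yes q (f p))
χ-⇔ (no ¬p) q f g = sym (χ-no q (¬p ∘ g))

χ-× : (p : Dec P) (q : Dec Q) → χ (p ×-dec q) ≡ χ p * χ q
χ-× (yes _) (yes _) = refl
χ-× (yes _) (no _)  = refl
χ-× (no _)  q       = refl

χ-⊎ : (p : Dec P) (q : Dec Q) → ¬ (P × Q) → χ (p ⊎-dec q) ≡ χ p + χ q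
χ-⊎ (yes p) (yes q) ¬pq = contradiction (p , q) ¬pq
χ-⊎ (yes _) (no _)  _   = refl
χ-⊎ (no _)  (yes _) _   = refl
χ-⊎ (no _)  (no _)  _   = refl

-- Allows a factor to be rewritten under the hypothesis that its indicator expresses: where the
-- indicator is 0, both products vanish. Most conditional steps in the sums below go through it.
χ-*-cong : ∀ {a b} (p : Dec P) → (P → a ≡ b) → χ p * a ≡ χ p * b
χ-*-cong (yes p) eq = cong (1ℤ *_) (eq p)
χ-*-cong (no _)  _  = refl

∑ : List A → (A → ℤ) → ℤ
∑ []       f = 0ℤ
∑ (x ∷ xs) f = f x + ∑ xs f

syntax ∑ xs (λ x → e) = ∑[ x ∈ xs ] e
infixr 1 ∑

module _ {f g : A → ℤ} where
  ∑-cong-∈ : ∀ xs → (∀ {x} → x ∈ xs → f x ≡ g x) → ∑ xs f ≡ ∑ xs g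
  ∑-cong-∈ []       eq = refl
  ∑-cong-∈ (x ∷ xs) eq = cong₂ _+_ (eq (here refl)) (∑-cong-∈ xs (eq ∘ there))

  ∑-cong : ∀ xs → (∀ x → f x ≡ g x) → ∑ xs f ≡ ∑ xs g
  ∑-cong xs eq = ∑-cong-∈ xs (λ {x} _ → eq x)

  ∑-≤ : ∀ xs → (∀ x → f x ≤ g x) → ∑ xs f ≤ ∑ xs g
  ∑-≤ []       le = ≤-refl
  ∑-≤ (x ∷ xs) le = +-mono-≤ (le x) (∑-≤ xs le)

∑-zero : ∀ (xs : List A) → (∑[ x ∈ xs ] 0ℤ) ≡ 0ℤ
∑-zero []       = refl
∑-zero (x ∷ xs) = trans (+-identityˡ _) (∑-zero xs)

module _ (f g : A → ℤ) where
  ∑-+ : ∀ xs → (∑[ x ∈ xs ] (f x + g x)) ≡ ∑ xs f + ∑ xs g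
  ∑-+ []       = refl
  ∑-+ (x ∷ xs) = trans (cong (_+_ (f x + g x)) (∑-+ xs)) (lem (f x) (g x) _ _)
    where
    lem : ∀ a b c d → a + b + (c + d) ≡ (a + c) + (b + d)
    lem = solve-∀

module _ (c : ℤ) (f : A → ℤ) where
  ∑-*ˡ : ∀ xs → (∑[ x ∈ xs ] (c * f x)) ≡ c * ∑ xs f
  ∑-*ˡ []       = sym (*-zeroʳ c)
  ∑-*ˡ (x ∷ xs) = trans (cong (_+_ (c * f x)) (∑-*ˡ xs)) (sym (*-distribˡ-+ c (f x) _))

  ∑-*ʳ : ∀ xs → (∑[ x ∈ xs ] (f x * c)) ≡ ∑ xs f * c
  ∑-*ʳ []       = refl
  ∑-*ʳ (x ∷ xs) = trans (cong (_+_ (f x * c)) (∑-*ʳ xs)) (sym (*-distribʳ-+ c (f x) _))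

∑-- : ∀ (f g : A → ℤ) xs → (∑[ x ∈ xs ] (f x - g x)) ≡ ∑ xs f - ∑ xs g
∑-- f g xs = begin
  (∑[ x ∈ xs ] (f x - g x))                ≡⟨ ∑-+ f (λ x → - g x) xs ⟩
  ∑ xs f + (∑[ x ∈ xs ] (- g x))           ≡⟨ cong (_+_ (∑ xs f)) (∑-cong xs λ x → sym (-1*i≡-i (g x))) ⟩
  ∑ xs f + (∑[ x ∈ xs ] (-1ℤ * g x))       ≡⟨ cong (_+_ (∑ xs f)) (trans (∑-*ˡ -1ℤ g xs) (-1*i≡-i _)) ⟩
  ∑ xs f - ∑ xs g                          ∎

-- Double counting with kernel `F`. The weights `g` and `h` stay apart from `F`, so that the outer
-- weight can serve as a hypothesis when the inner sum is evaluated.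
∑-exchange : ∀ (g : A → ℤ) (h : B → ℤ) (F : A → B → ℤ) xs ys →
  (∑[ x ∈ xs ] (g x * (∑[ y ∈ ys ] (h y * F x y)))) ≡
  (∑[ y ∈ ys ] (h y * (∑[ x ∈ xs ] (g x * F x y))))
∑-exchange g h F []       ys = sym (trans (∑-cong ys (λ y → *-zeroʳ (h y))) (∑-zero ys))
∑-exchange g h F (x ∷ xs) ys = begin
  g x * (∑[ y ∈ ys ] (h y * F x y)) + (∑[ z ∈ xs ] (g z * (∑[ y ∈ ys ] (h y * F z y))))
    ≡⟨ cong₂ _+_ (sym (∑-*ˡ (g x) _ ys)) (∑-exchange g h F xs ys) ⟩
  (∑[ y ∈ ys ] (g x * (h y * F x y))) + (∑[ y ∈ ys ] (h y * (∑[ z ∈ xs ] (g z * F z y))))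
    ≡⟨ ∑-+ _ _ ys ⟨
  (∑[ y ∈ ys ] (g x * (h y * F x y) + h y * (∑[ z ∈ xs ] (g z * F z y))))
    ≡⟨ ∑-cong ys (λ y → lem (g x) (h y) (F x y) _) ⟩
  (∑[ y ∈ ys ] (h y * (g x * F x y + (∑[ z ∈ xs ] (g z * F z y)))))  ∎
  where
  lem : ∀ a b c d → a * (b * c) + b * d ≡ b * (a * c + d)
  lem = solve-∀

module _ {f : A → ℤ} where
  0≤-∑ : ∀ xs → (∀ x → 0ℤ ≤ f x) → 0ℤ ≤ ∑ xs f
  0≤-∑ xs 0≤f = subst (_≤ ∑ xs f) (∑-zero xs) (∑-≤ xs 0≤f)

  ∑≡0⇒≡0 : ∀ {xs} → (∀ x → 0ℤ ≤ f x) → ∑ xs f ≡ 0ℤ → ∀ {x} → x ∈ xs → f x ≡ 0ℤ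
  ∑≡0⇒≡0 {x ∷ xs} 0≤f eq (here refl) = proj₁ (0≤∧0≤∧+≡0⇒≡0 (0≤f x) (0≤-∑ xs 0≤f) eq)
  ∑≡0⇒≡0 {x ∷ xs} 0≤f eq (there x∈)  =
    ∑≡0⇒≡0 0≤f (proj₂ (0≤∧0≤∧+≡0⇒≡0 (0≤f x) (0≤-∑ xs 0≤f) eq)) x∈

-- The differences `g x - f x` are non-negative and sum to 0. This turns an equality of
-- cardinalities into an equality of sets.
∑-≤-tight : ∀ {f g : A → ℤ} {xs} → (∀ x → f x ≤ g x) → ∑ xs f ≡ ∑ xs g →
  ∀ {x} → x ∈ xs → f x ≡ g x
∑-≤-tight {f = f} {g} {xs} f≤g eq {x} x∈ = sym (i-j≡0⇒i≡j (g x) (f x)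
  (∑≡0⇒≡0 (λ y → i≤j⇒0≤j-i (f≤g y)) (trans (∑-- g f xs) (i≡j⇒i-j≡0 (sym eq))) x∈))

module _ {P : A → Set} (P? : ∀ x → Dec (P x)) where
  length-filter-∑ : ∀ xs → + length (filter P? xs) ≡ (∑[ x ∈ xs ] χ (P? x))
  length-filter-∑ []       = refl
  length-filter-∑ (x ∷ xs) with P? x
  ... | yes _ = cong (_+_ 1ℤ) (length-filter-∑ xs)
  ... | no _  = trans (length-filter-∑ xs) (sym (+-identityˡ _))

  ∑χ≡0 : ∀ xs → (∀ {x} → x ∈ xs → ¬ P x) → (∑[ x ∈ xs ] χ (P? x)) ≡ 0ℤ
  ∑χ≡0 xs ¬P = trans (∑-cong-∈ xs (λ {x} x∈ → χ-no (P? x) (¬P x∈))) (∑-zero xs)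

  ∑χ≡1 : ∀ {xs x} → Unique xs → x ∈ xs → P x → (∀ {y} → y ∈ xs → P y → y ≡ x) →
    (∑[ y ∈ xs ] χ (P? y)) ≡ 1ℤ
  ∑χ≡1 {x ∷ xs} (x∉xs ∷ _) (here refl) Px uniq =
    cong₂ _+_ (χ-yes (P? x) Px)
      (∑χ≡0 xs λ y∈ Py → All.lookup x∉xs y∈ (sym (uniq (there y∈) Py)))
  ∑χ≡1 {z ∷ xs} (z∉xs ∷ u) (there x∈) Px uniq =
    trans (cong₂ _+_ (χ-no (P? z) λ Pz → All.lookup z∉xs x∈ (uniq (here refl) Pz))
                     (∑χ≡1 u x∈ Px (uniq ∘ there)))
          (+-identityˡ 1ℤ)

∑-tabulate-cong : ∀ {n} (f : A → ℤ) (g : B → ℤ) (a : Fin n → A) (b : Fin n → B) →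
  (∀ i → f (a i) ≡ g (b i)) → ∑ (tabulate a) f ≡ ∑ (tabulate b) g
∑-tabulate-cong {n = ℕ.zero} f g a b eq = refl
∑-tabulate-cong {n = suc n}  f g a b eq =
  cong₂ _+_ (eq zero) (∑-tabulate-cong f g (a ∘ Fin.suc) (b ∘ Fin.suc) (eq ∘ Fin.suc))

∑-allFin-suc : ∀ n (f : Fin (suc n) → ℤ) →
  ∑ (allFin (suc n)) f ≡ f zero + (∑[ x ∈ allFin n ] f (Fin.suc x))
∑-allFin-suc n f = cong (_+_ (f zero)) (∑-tabulate-cong f (f ∘ Fin.suc) Fin.suc id λ _ → refl)

∑-const : ∀ n c → (∑[ x ∈ allFin n ] c) ≡ + n * c
∑-const ℕ.zero  c = refl
∑-const (suc n) c = begin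
  (∑[ x ∈ allFin (suc n) ] c)  ≡⟨ ∑-allFin-suc n (λ _ → c) ⟩
  c + (∑[ x ∈ allFin n ] c)    ≡⟨ cong (_+_ c) (∑-const n c) ⟩
  c + + n * c                  ≡⟨ suc-* (+ n) c ⟨
  + suc n * c                  ∎

-- Finite subsets

∣∣-∑ : ∀ {n} (D : Subset n) → + ∣ D ∣ ≡ (∑[ x ∈ allFin n ] χ (x ∈? D))
∣∣-∑ []            = refl
∣∣-∑ (outside ∷ D) = trans (∣∣-∑ D)
  (sym (trans (∑-allFin-suc _ (λ x → χ (x ∈? outside ∷ D))) (+-identityˡ _)))
∣∣-∑ (inside ∷ D)  = trans (cong (_+_ 1ℤ) (∣∣-∑ D))
  (sym (∑-allFin-suc _ (λ x → χ (x ∈? inside ∷ D))))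

module _ {n} {P : Fin n → Set} (P? : ∀ x → Dec (P x)) where
  comprehension : Subset n
  comprehension = Vec.tabulate (does ∘ P?)

  ∈-comprehension⁺ : ∀ {x} → P x → x Subset.∈ comprehension
  ∈-comprehension⁺ {x} Px with P? x in eq
  ... | yes _  = Vec.lookup⇒[]= x comprehension
                   (trans (Vec.lookup∘tabulate _ x) (cong does eq))
  ... | no ¬Px = contradiction Px ¬Px

  ∈-comprehension⁻ : ∀ {x} → x Subset.∈ comprehension → P x
  ∈-comprehension⁻ {x} x∈ with P? x | trans (sym (Vec.lookup∘tabulate (does ∘ P?) x)) (Vec.[]=⇒lookup x∈)
  ... | yes Px | _  = Px

  ∣comprehension∣ : + ∣ comprehension ∣ ≡ (∑[ x ∈ allFin n ] χ (P? x))
  ∣comprehension∣ = trans (∣∣-∑ comprehension) (∑-cong (allFin n) λ x →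
    χ-⇔ (x ∈? comprehension) (P? x) ∈-comprehension⁻ ∈-comprehension⁺)

subsets : ∀ n → List (Subset n)
subsets ℕ.zero  = [] ∷ []
subsets (suc n) = map (inside ∷_) (subsets n) ++ map (outside ∷_) (subsets n)

∈-subsets : ∀ {n} (D : Subset n) → D ∈ subsets n
∈-subsets []            = here refl
∈-subsets (inside ∷ D)  = ∈-++⁺ˡ (∈-map⁺ (inside ∷_) (∈-subsets D))
∈-subsets (outside ∷ D) =
  ∈-++⁺ʳ (map (inside ∷_) (subsets _)) (∈-map⁺ (outside ∷_) (∈-subsets D))

-- Freedom from repetition lets a sum over the filtered list `blocks` count each block once.
subsets-unique : ∀ n → Unique (subsets n)
subsets-unique ℕ.zero  = All.[] ∷ []
subsets-unique (suc n) = Unique.++⁺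
  (Unique.map⁺ Vec.∷-injectiveʳ (subsets-unique n))
  (Unique.map⁺ Vec.∷-injectiveʳ (subsets-unique n))
  disjoint
  where
  disjoint : ∀ {D} → ¬ (D ∈ map (inside ∷_) (subsets n) × D ∈ map (outside ∷_) (subsets n))
  disjoint (∈₁ , ∈₂) with ∈-map⁻ (inside ∷_) ∈₁ | ∈-map⁻ (outside ∷_) ∈₂
  ... | _ , _ , refl | _ , _ , ()

-- Graph counts as integer sums

module Counting {v} (G : Graph v) where
  open Graph G renaming (sym to adj-sym) public

  V : List (Fin v)
  V = allFin v

  ι : Subset v → Fin v → ℤ
  ι D x = χ (x ∈? D)

  -- Entries of the adjacency matrix, of the identity matrix and of the adjacency matrix of the
  -- complement.
  a δ ν : Fin v → Fin v → ℤ
  a x y = χ (adj? x y)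
  δ x y = χ (x ≟ y)
  ν x y = 1ℤ - δ x y - a x y

  nb : Subset v → Fin v → ℤ
  nb D x = ∑[ w ∈ V ] (ι D w * a x w)

  a-sym : ∀ x y → a x y ≡ a y x
  a-sym x y = χ-⇔ (adj? x y) (adj? y x) adj-sym adj-sym

  a-irrefl : ∀ x → a x x ≡ 0ℤ
  a-irrefl x = χ-no (adj? x x) irrefl

  ν-sym : ∀ x y → ν x y ≡ ν y x
  ν-sym x y = cong₂ (λ d b → 1ℤ - d - b) (χ-⇔ (x ≟ y) (y ≟ x) sym sym) (a-sym x y)

  ν-adj : ∀ {x y} → Adj x y → ν x y ≡ 0ℤ
  ν-adj {x} {y} xy = cong₂ (λ d b → 1ℤ - d - b)
    (χ-no (x ≟ y) λ { refl → irrefl xy }) (χ-yes (adj? x y) xy)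

  ν-nonadj : ∀ {x y} → x ≢ y → ¬ Adj x y → ν x y ≡ 1ℤ
  ν-nonadj {x} {y} x≢y ¬xy =
    cong₂ (λ d b → 1ℤ - d - b) (χ-no (x ≟ y) x≢y) (χ-no (adj? x y) ¬xy)

  ν-cases : ∀ x y → ν x y ≡ 0ℤ ⊎ (x ≢ y × ¬ Adj x y)
  ν-cases x y with x ≟ y | adj? x y
  ... | yes refl | yes xx = contradiction xx irrefl
  ... | yes _    | no _   = inj₁ refl
  ... | no _     | yes _  = inj₁ refl
  ... | no x≢y   | no ¬xy = inj₂ (x≢y , ¬xy)

  0≤ν : ∀ x y → 0ℤ ≤ ν x y
  0≤ν x y with ν-cases x y
  ... | inj₁ eq          = ≤-reflexive (sym eq)
  ... | inj₂ (x≢y , ¬xy) = subst (0ℤ ≤_) (sym (ν-nonadj x≢y ¬xy)) (+≤+ z≤n)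

  ∑-δ : ∀ (f : Fin v → ℤ) x → (∑[ w ∈ V ] (f w * δ x w)) ≡ f x
  ∑-δ f x = begin
    (∑[ w ∈ V ] (f w * δ x w))  ≡⟨ ∑-cong V (λ w → trans (*-comm (f w) (δ x w))
                                     (trans (χ-*-cong (x ≟ w) (λ { refl → refl }))
                                            (*-comm (δ x w) (f x)))) ⟩
    (∑[ w ∈ V ] (f x * δ x w))  ≡⟨ ∑-*ˡ (f x) (δ x) V ⟩
    f x * ∑ V (δ x)             ≡⟨ cong (f x *_) (∑χ≡1 (x ≟_) (Unique.allFin⁺ v) (∈-allFin x)
                                     refl (λ _ → sym)) ⟩
    f x * 1ℤ                    ≡⟨ *-identityʳ (f x) ⟩
    f x                         ∎

  degree-∑ : ∀ x → + degree G x ≡ ∑ V (a x)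
  degree-∑ x = length-filter-∑ (adj? x) V

  commonNbrs-∑ : ∀ x y → + commonNbrs G x y ≡ (∑[ z ∈ V ] (a x z * a y z))
  commonNbrs-∑ x y = trans (length-filter-∑ (λ z → adj? x z ×-dec adj? y z) V)
    (∑-cong V λ z → χ-× (adj? x z) (adj? y z))

  nbrsIn-∑ : ∀ x D → + nbrsIn G x D ≡ nb D x
  nbrsIn-∑ x D = trans (length-filter-∑ (λ y → (y ∈? D) ×-dec adj? x y) V)
    (∑-cong V λ y → χ-× (y ∈? D) (adj? x y))

  -- In a clique through `x`, only `x` itself fails to be a neighbour of `x`.
  clique-a : ∀ {D x} → IsClique G D → x Subset.∈ D → ∀ w → ι D w * a x w ≡ ι D w - ι D w * δ x w
  clique-a {D} {x} clique x∈D w = trans (χ-*-cong (w ∈? D) a≡1-δ) (lem (ι D w) (δ x w))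
    where
    lem : ∀ i d → i * (1ℤ - d) ≡ i - i * d
    lem = solve-∀
    a≡1-δ : w Subset.∈ D → a x w ≡ 1ℤ - δ x w
    a≡1-δ w∈D with x ≟ w
    ... | yes refl = a-irrefl x
    ... | no x≢w   = χ-yes (adj? x w) (clique x w x∈D w∈D x≢w)

  nb-inside : ∀ {D x} → IsClique G D → x Subset.∈ D → nb D x ≡ + ∣ D ∣ - 1ℤ
  nb-inside {D} {x} clique x∈D = begin
    nb D x                                  ≡⟨ ∑-cong V (clique-a clique x∈D) ⟩
    (∑[ w ∈ V ] (ι D w - ι D w * δ x w))    ≡⟨ ∑-- (ι D) (λ w → ι D w * δ x w) V ⟩
    ∑ V (ι D) - (∑[ w ∈ V ] (ι D w * δ x w)) ≡⟨ cong₂ _-_ (sym (∣∣-∑ D)) (∑-δ (ι D) x) ⟩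
    + ∣ D ∣ - ι D x                         ≡⟨ cong (_-_ (+ ∣ D ∣)) (χ-yes (x ∈? D) x∈D) ⟩
    + ∣ D ∣ - 1ℤ                            ∎

  -- A single expression, affine in `ι D x`, covers the vertices inside and outside the clique, so
  -- that sums over all vertices reduce to `∑-linear`.
  nb-nexus : ∀ {D m} → IsClique G D → (∀ x → x Subset.∉ D → nb D x ≡ m) →
    ∀ x → nb D x ≡ m + ι D x * (+ ∣ D ∣ - 1ℤ - m)
  nb-nexus {D} {m} clique out x with x ∈? D
  ... | yes x∈D = trans (nb-inside clique x∈D) (lem (+ ∣ D ∣) m)
    where
    lem : ∀ n m → n - 1ℤ ≡ m + 1ℤ * (n - 1ℤ - m)
    lem = solve-∀
  ... | no x∉D  = trans (out x x∉D) (sym (+-identityʳ m))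

  ∑-linear : ∀ D p q → (∑[ w ∈ V ] (p + ι D w * q)) ≡ + v * p + + ∣ D ∣ * q
  ∑-linear D p q = begin
    (∑[ w ∈ V ] (p + ι D w * q))                   ≡⟨ ∑-+ (λ _ → p) (λ w → ι D w * q) V ⟩
    (∑[ w ∈ V ] p) + (∑[ w ∈ V ] (ι D w * q))      ≡⟨ cong₂ _+_ (∑-const v p) (∑-*ʳ q (ι D) V) ⟩
    + v * p + ∑ V (ι D) * q                        ≡⟨ cong (λ n → + v * p + n * q) (∣∣-∑ D) ⟨
    + v * p + + ∣ D ∣ * q                          ∎

-- Counting in edge-regular graphs

module EdgeRegular {v k l : ℕ} (G : Graph v) (er : IsEdgeRegular G k l) where
  open Counting G

  ∑-a : ∀ x → ∑ V (a x) ≡ + k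
  ∑-a x = trans (sym (degree-∑ x)) (cong +_ (proj₁ er x))

  ∑-a-a : ∀ {x y} → Adj x y → (∑[ z ∈ V ] (a x z * a y z)) ≡ + l
  ∑-a-a {x} {y} xy = trans (sym (commonNbrs-∑ x y)) (cong +_ (proj₂ er x y xy))

  ∑-ν : ∀ x → ∑ V (ν x) ≡ + v - 1ℤ - + k
  ∑-ν x = begin
    ∑ V (ν x)                                    ≡⟨ ∑-- (λ w → 1ℤ - δ x w) (a x) V ⟩
    (∑[ w ∈ V ] (1ℤ - δ x w)) - ∑ V (a x)        ≡⟨ cong₂ _-_ (∑-- (λ _ → 1ℤ) (δ x) V) (∑-a x) ⟩
    (∑[ w ∈ V ] 1ℤ) - ∑ V (δ x) - + k
      ≡⟨ cong₂ (λ p q → p - q - + k) (trans (∑-const v 1ℤ) (*-identityʳ (+ v)))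
           (trans (∑-cong V (λ w → sym (*-identityˡ (δ x w)))) (∑-δ (λ _ → 1ℤ) x)) ⟩
    + v - 1ℤ - + k                               ∎

  -- By inclusion and exclusion this number counts the vertices adjacent to neither `x` nor `y`. It
  -- is the leading coefficient `coefA` of the quadratic for s.
  0≤v+l-2k : ∀ {x y} → Adj x y → 0ℤ ≤ + v + + l - + 2 * + k
  0≤v+l-2k {x} {y} xy = subst (0ℤ ≤_) eq
    (0≤-∑ V λ z → 0≤-* (0≤1-χ (adj? x z)) (0≤1-χ (adj? y z)))
    where
    0≤1-χ : ∀ {P : Set} (p : Dec P) → 0ℤ ≤ 1ℤ - χ p
    0≤1-χ (yes _) = +≤+ z≤n
    0≤1-χ (no _)  = +≤+ z≤n
    lem : ∀ p q → (1ℤ - p) * (1ℤ - q) ≡ (1ℤ + p * q) - (p + q)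
    lem = solve-∀
    lem′ : ∀ v l k → (v * 1ℤ + l) - (k + k) ≡ v + l - + 2 * k
    lem′ = solve-∀
    eq : (∑[ z ∈ V ] ((1ℤ - a x z) * (1ℤ - a y z))) ≡ + v + + l - + 2 * + k
    eq = begin
      (∑[ z ∈ V ] ((1ℤ - a x z) * (1ℤ - a y z)))
        ≡⟨ ∑-cong V (λ z → lem (a x z) (a y z)) ⟩
      (∑[ z ∈ V ] ((1ℤ + a x z * a y z) - (a x z + a y z)))
        ≡⟨ ∑-- (λ z → 1ℤ + a x z * a y z) (λ z → a x z + a y z) V ⟩
      (∑[ z ∈ V ] (1ℤ + a x z * a y z)) - (∑[ z ∈ V ] (a x z + a y z))
        ≡⟨ cong₂ _-_ (∑-+ (λ _ → 1ℤ) (λ z → a x z * a y z) V) (∑-+ (a x) (a y) V) ⟩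
      ((∑[ z ∈ V ] 1ℤ) + (∑[ z ∈ V ] (a x z * a y z))) - (∑ V (a x) + ∑ V (a y))
        ≡⟨ cong₂ _-_ (cong₂ _+_ (∑-const v 1ℤ) (∑-a-a xy)) (cong₂ _+_ (∑-a x) (∑-a y)) ⟩
      (+ v * 1ℤ + + l) - (+ k + + k)
        ≡⟨ lem′ (+ v) (+ l) (+ k) ⟩
      + v + + l - + 2 * + k  ∎

  ∑-nb : ∀ D → ∑ V (nb D) ≡ + ∣ D ∣ * + k
  ∑-nb D = begin
    ∑ V (nb D)                                            ≡⟨ ∑-cong V (λ x → *-identityˡ (nb D x)) ⟨
    (∑[ x ∈ V ] (1ℤ * nb D x))                            ≡⟨ ∑-exchange (λ _ → 1ℤ) (ι D) a V V ⟩
    (∑[ w ∈ V ] (ι D w * (∑[ x ∈ V ] (1ℤ * a x w))))      ≡⟨ ∑-cong V (λ w → cong (ι D w *_) (column w)) ⟩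
    (∑[ w ∈ V ] (ι D w * + k))                            ≡⟨ ∑-*ʳ (+ k) (ι D) V ⟩
    ∑ V (ι D) * + k                                       ≡⟨ cong (_* + k) (∣∣-∑ D) ⟨
    + ∣ D ∣ * + k                                         ∎
    where
    column : ∀ w → (∑[ x ∈ V ] (1ℤ * a x w)) ≡ + k
    column w = trans (∑-cong V λ x → trans (*-identityˡ (a x w)) (a-sym x w)) (∑-a w)

  -- Moments of the neighbour counts of a clique

  module _ {D} (clique : IsClique G D) where
    private n = + ∣ D ∣

    -- Two distinct vertices of the clique are adjacent and have l common neighbours; for `w = x`
    -- the inner sum is the valency k.
    clique-a-a : ∀ {x} → x Subset.∈ D → ∀ w →
      ι D w * (∑[ y ∈ V ] (a x y * a y w)) ≡ ι D w * (+ l + δ x w * (+ k - + l))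
    clique-a-a {x} x∈D w = χ-*-cong (w ∈? D) λ w∈D →
      trans (∑-cong V λ y → cong (a x y *_) (a-sym y w)) (common w∈D)
      where
      lem : ∀ k l → k ≡ l + 1ℤ * (k - l)
      lem = solve-∀
      common : w Subset.∈ D → (∑[ y ∈ V ] (a x y * a w y)) ≡ + l + δ x w * (+ k - + l)
      common w∈D with x ≟ w
      ... | yes refl = trans (∑-cong V λ y → trans (χ-*-cong (adj? x y) (χ-yes (adj? x y)))
                                                   (*-identityʳ (a x y)))
                             (trans (∑-a x) (lem (+ k) (+ l)))
      ... | no x≢w   = trans (∑-a-a (clique x w x∈D w∈D x≢w)) (sym (+-identityʳ (+ l)))

    -- Counts the walks of length 2 from `x` back into the clique: k of them return to `x`, and l
    -- end at each of the n - 1 other vertices.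
    ∑-a-nb : ∀ {x} → x Subset.∈ D → (∑[ y ∈ V ] (a x y * nb D y)) ≡ n * + l + (+ k - + l)
    ∑-a-nb {x} x∈D = begin
      (∑[ y ∈ V ] (a x y * nb D y))
        ≡⟨ ∑-exchange (a x) (ι D) a V V ⟩
      (∑[ w ∈ V ] (ι D w * (∑[ y ∈ V ] (a x y * a y w))))
        ≡⟨ ∑-cong V (λ w → trans (clique-a-a x∈D w) (lem (ι D w) (δ x w) (+ l) (+ k - + l))) ⟩
      (∑[ w ∈ V ] (ι D w * + l + ι D w * δ x w * (+ k - + l)))
        ≡⟨ ∑-+ (λ w → ι D w * + l) (λ w → ι D w * δ x w * (+ k - + l)) V ⟩
      (∑[ w ∈ V ] (ι D w * + l)) + (∑[ w ∈ V ] (ι D w * δ x w * (+ k - + l)))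
        ≡⟨ cong₂ _+_ (∑-*ʳ (+ l) (ι D) V) (∑-*ʳ (+ k - + l) (λ w → ι D w * δ x w) V) ⟩
      ∑ V (ι D) * + l + (∑[ w ∈ V ] (ι D w * δ x w)) * (+ k - + l)
        ≡⟨ cong₂ (λ p q → p * + l + q * (+ k - + l)) {u = ∑[ w ∈ V ] (ι D w * δ x w)} (sym (∣∣-∑ D))
             (trans (∑-δ (ι D) x) (χ-yes (x ∈? D) x∈D)) ⟩
      n * + l + 1ℤ * (+ k - + l)
        ≡⟨ cong (_+_ (n * + l)) (*-identityˡ (+ k - + l)) ⟩
      n * + l + (+ k - + l)  ∎
      where
      lem : ∀ i d l c → i * (l + d * c) ≡ i * l + i * d * c
      lem = solve-∀

    -- One factor `nb D x` is expanded over the clique; then `∑-a-nb` evaluates the inner sum at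
    -- each clique vertex.
    ∑-nb-nb : (∑[ x ∈ V ] (nb D x * nb D x)) ≡ n * (n * + l + (+ k - + l))
    ∑-nb-nb = begin
      (∑[ x ∈ V ] (nb D x * nb D x))
        ≡⟨ ∑-exchange (nb D) (ι D) a V V ⟩
      (∑[ w ∈ V ] (ι D w * (∑[ x ∈ V ] (nb D x * a x w))))
        ≡⟨ ∑-cong V (λ w → χ-*-cong (w ∈? D) λ w∈D →
             trans (∑-cong V λ x → trans (*-comm (nb D x) (a x w)) (cong (_* nb D x) (a-sym x w)))
                   (∑-a-nb w∈D)) ⟩
      (∑[ w ∈ V ] (ι D w * (n * + l + (+ k - + l))))
        ≡⟨ ∑-*ʳ _ (ι D) V ⟩
      ∑ V (ι D) * (n * + l + (+ k - + l))
        ≡⟨ cong (_* (n * + l + (+ k - + l))) (∣∣-∑ D) ⟨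
      n * (n * + l + (+ k - + l))  ∎

    deviation : ℤ → ℤ
    deviation m = ∑[ x ∈ V ] ((1ℤ - ι D x) * ((nb D x - m) * (nb D x - m)))

    -- The square is expanded over all vertices, and its values on `D`, where the neighbour count is
    -- n - 1, are subtracted. The result involves `D` only through its order.
    deviation-formula : ∀ m → deviation m ≡
      n * (n * + l + (+ k - + l)) - + 2 * m * (n * + k)
        + (+ v * (m * m) + n * - ((n - 1ℤ - m) * (n - 1ℤ - m)))
    deviation-formula m = begin
      deviation m
        ≡⟨ ∑-cong V (λ x → trans (lem (ι D x) (nb D x) m)
             (trans (cong (λ p → sq x - mul x + (m * m - p)) (χ-*-cong (x ∈? D) λ x∈D →
                       cong (λ b → (b - m) * (b - m)) (nb-inside clique x∈D)))
                    (lem′ (sq x - mul x) (m * m) (ι D x) c))) ⟩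
      (∑[ x ∈ V ] (sq x - mul x + (m * m + ι D x * - c)))
        ≡⟨ ∑-+ (λ x → sq x - mul x) (λ x → m * m + ι D x * - c) V ⟩
      (∑[ x ∈ V ] (sq x - mul x)) + (∑[ x ∈ V ] (m * m + ι D x * - c))
        ≡⟨ cong₂ _+_ (∑-- sq mul V) (∑-linear D (m * m) (- c)) ⟩
      ∑ V sq - ∑ V mul + (+ v * (m * m) + n * - c)
        ≡⟨ cong₂ (λ p q → p - q + (+ v * (m * m) + n * - c)) ∑-nb-nb
             (trans (∑-*ˡ (+ 2 * m) (nb D) V) (cong ((+ 2 * m) *_) (∑-nb D))) ⟩
      n * (n * + l + (+ k - + l)) - + 2 * m * (n * + k) + (+ v * (m * m) + n * - c)  ∎
      where
      c = (n - 1ℤ - m) * (n - 1ℤ - m)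
      sq mul : Fin v → ℤ
      sq x = nb D x * nb D x
      mul x = + 2 * m * nb D x
      lem : ∀ i b m → (1ℤ - i) * ((b - m) * (b - m)) ≡
        b * b - + 2 * m * b + (m * m - i * ((b - m) * (b - m)))
      lem = solve-∀
      lem′ : ∀ p q i c → p + (q - i * c) ≡ p + (q + i * - c)
      lem′ = solve-∀

    deviation≡0⇒nexus : ∀ {m} → deviation m ≡ 0ℤ → ∀ x → x Subset.∉ D → nb D x ≡ m
    deviation≡0⇒nexus {m} eq x x∉D = i-j≡0⇒i≡j (nb D x) m (square≡0 (begin
      (nb D x - m) * (nb D x - m)                      ≡⟨ *-identityˡ _ ⟨
      1ℤ * ((nb D x - m) * (nb D x - m))               ≡⟨ cong (λ i → (1ℤ - i) * ((nb D x - m) * (nb D x - m)))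
                                                            (χ-no (x ∈? D) x∉D) ⟨
      (1ℤ - ι D x) * ((nb D x - m) * (nb D x - m))     ≡⟨ ∑≡0⇒≡0 nonneg eq (∈-allFin x) ⟩
      0ℤ                                               ∎))
      where
      square≡0 : ∀ {i} → i * i ≡ 0ℤ → i ≡ 0ℤ
      square≡0 {i} eq with i*j≡0⇒i≡0∨j≡0 i eq
      ... | inj₁ p = p
      ... | inj₂ p = p
      0≤1-ι : ∀ y → 0ℤ ≤ 1ℤ - ι D y
      0≤1-ι y with y ∈? D
      ... | yes _ = +≤+ z≤n
      ... | no _  = +≤+ z≤n
      nonneg : ∀ y → 0ℤ ≤ (1ℤ - ι D y) * ((nb D y - m) * (nb D y - m))
      nonneg y = 0≤-* (0≤1-ι y) (0≤-square (nb D y - m))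

    nexus⇒deviation≡0 : ∀ {m} → (∀ x → x Subset.∉ D → nb D x ≡ m) → deviation m ≡ 0ℤ
    nexus⇒deviation≡0 {m} out = trans (∑-cong V term) (∑-zero V)
      where
      term : ∀ x → (1ℤ - ι D x) * ((nb D x - m) * (nb D x - m)) ≡ 0ℤ
      term x with x ∈? D
      ... | yes _   = refl
      ... | no x∉D rewrite out x x∉D | +-inverseʳ m = refl

    -- The sum of the neighbour counts over all vertices is evaluated once by the nexus and once by
    -- the valency.
    ∑-nexus : ∀ {m} → (∀ x → x Subset.∉ D → nb D x ≡ m) → + v * m + n * (n - 1ℤ - m) ≡ n * + k
    ∑-nexus {m} out = begin
      + v * m + n * (n - 1ℤ - m)               ≡⟨ ∑-linear D m (n - 1ℤ - m) ⟨
      (∑[ x ∈ V ] (m + ι D x * (n - 1ℤ - m)))  ≡⟨ ∑-cong V (nb-nexus clique out) ⟨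
      ∑ V (nb D)                               ≡⟨ ∑-nb D ⟩
      n * + k                                  ∎

-- Cliques of order s + 1

module Blocks {v k l s e : ℕ} (G : Graph v) (er : IsEdgeRegular G k l)
  (nexus : ∀ {D} → IsClique G D → ∣ D ∣ ≡ suc s → ∀ x → x Subset.∉ D →
    Counting.nb G D x ≡ + e)
  (extend : ∀ C → IsClique G C → ∣ C ∣ ≡ suc e →
    Σ (Subset v) λ D → IsClique G D × ∣ D ∣ ≡ suc s × C ⊆ D)
  where
  open Counting G
  open EdgeRegular G er

  IsBlock : Subset v → Set
  IsBlock D = IsClique G D × ∣ D ∣ ≡ suc s

  isBlock? : ∀ D → Dec (IsBlock D)
  isBlock? D = (all? λ x → all? λ y → (x ∈? D) →-dec (y ∈? D) →-dec ¬? (x ≟ y) →-dec adj? x y)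
    ×-dec (∣ D ∣ ℕ.≟ suc s)

  blocks : List (Subset v)
  blocks = filter isBlock? (subsets v)

  blocks-unique : Unique blocks
  blocks-unique = Unique.filter⁺ isBlock? (subsets-unique v)

  ∈-blocks⁺ : ∀ {D} → IsBlock D → D ∈ blocks
  ∈-blocks⁺ {D} = ∈-filter⁺ isBlock? (∈-subsets D)

  ∈-blocks⁻ : ∀ {D} → D ∈ blocks → IsBlock D
  ∈-blocks⁻ D∈ = proj₂ (∈-filter⁻ isBlock? {xs = subsets v} D∈)

  nb-block : ∀ {D} → IsBlock D → ∀ x → nb D x ≡ + e + ι D x * (+ s - + e)
  nb-block {D} (clique , size) x = trans (nb-nexus clique (nexus clique size) x)
    (cong (λ n → + e + ι D x * (+ n - 1ℤ - + e)) size)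

  nonadj⇒∉ : ∀ {D x y} → IsClique G D → x ≢ y → ¬ Adj x y → x Subset.∈ D → y Subset.∉ D
  nonadj⇒∉ {x = x} {y} clique x≢y ¬xy x∈D y∈D = ¬xy (clique x y x∈D y∈D x≢y)

  -- A vertex `z` of one block outside the other would be adjacent to all e + 1 vertices of `E`,
  -- whereas the nexus allows it only e neighbours in the other block.
  block-unique : ∀ {E D D′} → ∣ E ∣ ≡ suc e → IsBlock D → IsBlock D′ → E ⊆ D → E ⊆ D′ → D ≡ D′
  block-unique {E} size D-block D′-block E⊆D E⊆D′ =
    ⊆-antisym (sub D′-block D-block E⊆D′ E⊆D) (sub D-block D′-block E⊆D E⊆D′)
    where
    sub : ∀ {D₁ D₂} → IsBlock D₁ → IsBlock D₂ → E ⊆ D₁ → E ⊆ D₂ → D₂ ⊆ D₁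
    sub {D₁} {D₂} (clique₁ , size₁) (clique₂ , _) E⊆D₁ E⊆D₂ {z} z∈D₂ =
      decidable-stable (z ∈? D₁) λ z∉D₁ → ℕₚ.1+n≰n (drop‿+≤+
        (subst₂ _≤_ (trans (sym (∣∣-∑ E)) (cong +_ size)) (nexus clique₁ size₁ z z∉D₁)
          (∑-≤ V (le z∉D₁))))
      where
      le : z Subset.∉ D₁ → ∀ w → ι E w ≤ ι D₁ w * a z w
      le z∉D₁ w with w ∈? E
      ... | no _    = 0≤-* (0≤χ (w ∈? D₁)) (0≤χ (adj? z w))
      ... | yes w∈E = ≤-reflexive (sym (cong₂ _*_ (χ-yes (w ∈? D₁) (E⊆D₁ w∈E))
        (χ-yes (adj? z w) (clique₂ z w z∈D₂ (E⊆D₂ w∈E) λ { refl → z∉D₁ (E⊆D₁ w∈E) }))))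

  -- Numbers of blocks through one or two vertices

  c₁ : Fin v → ℤ
  c₁ x = ∑[ D ∈ blocks ] ι D x

  c₂ : Fin v → Fin v → ℤ
  c₂ x y = ∑[ D ∈ blocks ] (ι D x * ι D y)

  c₂-sym : ∀ x y → c₂ x y ≡ c₂ y x
  c₂-sym x y = ∑-cong blocks λ D → *-comm (ι D x) (ι D y)

  meet : Subset v → Subset v → ℤ
  meet D D′ = ∑[ w ∈ V ] (ι D w * ι D′ w)

  meet-sym : ∀ D D′ → meet D D′ ≡ meet D′ D
  meet-sym D D′ = ∑-cong V λ w → *-comm (ι D w) (ι D′ w)

  meets? : ∀ D D′ → Dec (meet D D′ ≡ + e)
  meets? D D′ = meet D D′ ℤ.≟ + e

  -- The partner is the block through y and the e neighbours of y in D.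
  partner-count : ∀ {x y z D} → x ≢ y → ¬ Adj x y → Adj y z → IsBlock D →
    x Subset.∈ D → z Subset.∈ D →
    (∑[ D′ ∈ blocks ] (ι D′ y * ι D′ z * χ (meets? D D′))) ≡ 1ℤ
  partner-count {x} {y} {z} {D} x≢y ¬xy yz (clique , size) x∈D z∈D =
    trans (∑-cong blocks λ D′ → sym (trans (χ-× ((y ∈? D′) ×-dec (z ∈? D′)) (meets? D D′))
                                            (cong (_* χ (meets? D D′)) (χ-× (y ∈? D′) (z ∈? D′)))))
      (∑χ≡1 (λ D′ → ((y ∈? D′) ×-dec (z ∈? D′)) ×-dec meets? D D′) blocks-unique
        (∈-blocks⁺ (clique′ , size′))
        ((y∈D′ , E⊆D′ (∈-comprehension⁺ E? (inj₁ (z∈D , yz)))) , E⊆⇒meets clique′ y∈D′ E⊆D′)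
        -- Uniqueness: `y` has only e neighbours in `D`, so a block through `y` that meets `D` in e
        -- vertices contains all of them, hence `E`.
        (λ D″∈ ((y∈D″ , _) , meets) → let D″-block = ∈-blocks⁻ D″∈ in
          block-unique ∣E∣ D″-block (clique′ , size′) (meets⇒E⊆ (proj₁ D″-block) y∈D″ meets) E⊆D′))
    where
    y∉D : y Subset.∉ D
    y∉D = nonadj⇒∉ clique x≢y ¬xy x∈D

    InE : Fin v → Set
    InE w = (w Subset.∈ D × Adj y w) ⊎ y ≡ w

    E? : ∀ w → Dec (InE w)
    E? w = ((w ∈? D) ×-dec adj? y w) ⊎-dec (y ≟ w)

    E : Subset v
    E = comprehension E?

    ∑δ≡1 : ∑ V (δ y) ≡ 1ℤ
    ∑δ≡1 = ∑χ≡1 (y ≟_) (Unique.allFin⁺ v) (∈-allFin y) refl (λ _ → sym)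

    ∣E∣ : ∣ E ∣ ≡ suc e
    ∣E∣ = +-injective (begin
      + ∣ E ∣                                  ≡⟨ ∣comprehension∣ E? ⟩
      (∑[ w ∈ V ] χ (E? w))                    ≡⟨ ∑-cong V (λ w → trans
                                                    (χ-⊎ ((w ∈? D) ×-dec adj? y w) (y ≟ w)
                                                       λ { ((_ , yw) , refl) → irrefl yw })
                                                    (cong (_+ δ y w) (χ-× (w ∈? D) (adj? y w)))) ⟩
      (∑[ w ∈ V ] (ι D w * a y w + δ y w))     ≡⟨ ∑-+ (λ w → ι D w * a y w) (δ y) V ⟩
      nb D y + ∑ V (δ y)                       ≡⟨ cong₂ _+_ (nexus clique size y y∉D) ∑δ≡1 ⟩
      + e + 1ℤ                                 ≡⟨ +-comm (+ e) 1ℤ ⟩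
      + suc e                                  ∎)

    E-clique : IsClique G E
    E-clique p q p∈ q∈ p≢q with ∈-comprehension⁻ E? p∈ | ∈-comprehension⁻ E? q∈
    ... | inj₁ (p∈D , _) | inj₁ (q∈D , _) = clique p q p∈D q∈D p≢q
    ... | inj₁ (_ , yp)  | inj₂ refl      = adj-sym yp
    ... | inj₂ refl      | inj₁ (_ , yq)  = yq
    ... | inj₂ refl      | inj₂ refl      = contradiction refl p≢q

    D′ : Subset v
    D′ = proj₁ (extend E E-clique ∣E∣)

    clique′ : IsClique G D′
    clique′ = proj₁ (proj₂ (extend E E-clique ∣E∣))

    size′ : ∣ D′ ∣ ≡ suc s
    size′ = proj₁ (proj₂ (proj₂ (extend E E-clique ∣E∣)))

    E⊆D′ : E ⊆ D′
    E⊆D′ = proj₂ (proj₂ (proj₂ (extend E E-clique ∣E∣)))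

    y∈D′ : y Subset.∈ D′
    y∈D′ = E⊆D′ (∈-comprehension⁺ E? (inj₂ refl))

    ∈∩⇒adj : ∀ {B w} → IsClique G B → y Subset.∈ B → w Subset.∈ D → w Subset.∈ B → Adj y w
    ∈∩⇒adj {w = w} B-clique y∈B w∈D w∈B = B-clique y w y∈B w∈B λ { refl → y∉D w∈D }

    -- A vertex common to `D` and a clique `B` through `y` is a neighbour of `y`, as `y` is not in
    -- `D`.
    meet≤nb : ∀ {B} → IsClique G B → y Subset.∈ B → ∀ w → ι D w * ι B w ≤ ι D w * a y w
    meet≤nb {B} B-clique y∈B w with w ∈? D
    ... | no _    = ≤-refl
    ... | yes w∈D = *-monoˡ-≤-nonNeg 1ℤ le
      where
      le : ι B w ≤ a y w
      le with w ∈? B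
      ... | yes w∈B = ≤-reflexive (sym (χ-yes (adj? y w) (∈∩⇒adj B-clique y∈B w∈D w∈B)))
      ... | no _    = 0≤χ (adj? y w)

    -- Both sides of `meet≤nb` sum to e, so they agree at each vertex: every neighbour of `y` in `D`
    -- lies in `B`.
    meets⇒E⊆ : ∀ {B} → IsClique G B → y Subset.∈ B → meet D B ≡ + e → E ⊆ B
    meets⇒E⊆ {B} B-clique y∈B meets {w} w∈E with ∈-comprehension⁻ E? w∈E
    ... | inj₂ refl       = y∈B
    ... | inj₁ (w∈D , yw) = χ≢0⇒ (w ∈? B) λ ι≡0 → contradiction (begin
      1ℤ             ≡⟨ cong₂ _*_ (χ-yes (w ∈? D) w∈D) (χ-yes (adj? y w) yw) ⟨
      ι D w * a y w  ≡⟨ ∑-≤-tight (meet≤nb B-clique y∈B)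
                          (trans meets (sym (nexus clique size y y∉D))) (∈-allFin w) ⟨
      ι D w * ι B w  ≡⟨ cong (ι D w *_) ι≡0 ⟩
      ι D w * 0ℤ     ≡⟨ *-zeroʳ (ι D w) ⟩
      0ℤ             ∎) λ ()

    E⊆⇒meets : ∀ {B} → IsClique G B → y Subset.∈ B → E ⊆ B → meet D B ≡ + e
    E⊆⇒meets {B} B-clique y∈B E⊆B =
      trans (∑-cong V λ w → χ-*-cong (w ∈? D) λ w∈D →
               χ-⇔ (w ∈? B) (adj? y w) (∈∩⇒adj B-clique y∈B w∈D)
                 (λ yw → E⊆B (∈-comprehension⁺ E? (inj₁ (w∈D , yw)))))
            (nexus clique size y y∉D)

  -- Meeting in e vertices relates the blocks through x, z to the blocks through y, z. By
  -- `partner-count` each block on either side has exactly one partner, so both counts equal the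
  -- number of related pairs.
  c₂-nonadj : ∀ {x y z} → x ≢ y → ¬ Adj x y → Adj x z → Adj y z → c₂ x z ≡ c₂ y z
  c₂-nonadj {x} {y} {z} x≢y ¬xy xz yz = begin
    c₂ x z
      ≡⟨ absorb x y (λ D D′ → χ (meets? D D′)) (λ D-block → partner-count x≢y ¬xy yz D-block) ⟩
    (∑[ D ∈ blocks ] (ι D x * ι D z * (∑[ D′ ∈ blocks ] (ι D′ y * ι D′ z * χ (meets? D D′)))))
      ≡⟨ ∑-exchange (λ D → ι D x * ι D z) (λ D′ → ι D′ y * ι D′ z)
           (λ D D′ → χ (meets? D D′)) blocks blocks ⟩
    (∑[ D′ ∈ blocks ] (ι D′ y * ι D′ z * (∑[ D ∈ blocks ] (ι D x * ι D z * χ (meets? D D′)))))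
      ≡⟨ absorb y x (λ D′ D → χ (meets? D D′)) (λ {D′} D′-block y∈ z∈ →
           trans (∑-cong blocks λ D → cong (ι D x * ι D z *_) (meets-sym D D′))
                 (partner-count (x≢y ∘ sym) (¬xy ∘ adj-sym) xz D′-block y∈ z∈)) ⟨
    c₂ y z  ∎
    where
    meets-sym : ∀ D D′ → χ (meets? D D′) ≡ χ (meets? D′ D)
    meets-sym D D′ = χ-⇔ (meets? D D′) (meets? D′ D) (trans (meet-sym D′ D)) (trans (meet-sym D D′))

    -- Each term of the count is multiplied by its number of partners, which is 1.
    absorb : ∀ p q (F : Subset v → Subset v → ℤ) →
      (∀ {D} → IsBlock D → p Subset.∈ D → z Subset.∈ D →
         (∑[ D′ ∈ blocks ] (ι D′ q * ι D′ z * F D D′)) ≡ 1ℤ) →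
      c₂ p z ≡ (∑[ D ∈ blocks ] (ι D p * ι D z * (∑[ D′ ∈ blocks ] (ι D′ q * ι D′ z * F D D′))))
    absorb p q F one = ∑-cong-∈ blocks λ {D} D∈ → begin
      ι D p * ι D z                  ≡⟨ χ-× (p ∈? D) (z ∈? D) ⟨
      χ ((p ∈? D) ×-dec (z ∈? D))    ≡⟨ *-identityʳ _ ⟨
      χ ((p ∈? D) ×-dec (z ∈? D)) * 1ℤ
        ≡⟨ χ-*-cong ((p ∈? D) ×-dec (z ∈? D)) (λ (p∈ , z∈) → one (∈-blocks⁻ D∈) p∈ z∈) ⟨
      χ ((p ∈? D) ×-dec (z ∈? D)) * (∑[ D′ ∈ blocks ] (ι D′ q * ι D′ z * F D D′))
        ≡⟨ cong (_* (∑[ D′ ∈ blocks ] (ι D′ q * ι D′ z * F D D′))) (χ-× (p ∈? D) (z ∈? D)) ⟩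
      ι D p * ι D z * (∑[ D′ ∈ blocks ] (ι D′ q * ι D′ z * F D D′))  ∎

  -- Non-adjacent pairs in the neighbourhood of a vertex

  σ κ M : ℤ
  σ = + suc s - + e
  κ = + k - 1ℤ - + l
  M = κ + σ

  -- Of the k neighbours of `z`, one is `u` and l are adjacent to `u`. Thus κ is the valency of the
  -- complement of the graph induced on N(z).
  ∑-a-ν : ∀ {z u} → Adj z u → (∑[ w ∈ V ] (a z w * ν u w)) ≡ κ
  ∑-a-ν {z} {u} zu = begin
    (∑[ w ∈ V ] (a z w * ν u w))
      ≡⟨ ∑-cong V (λ w → lem (a z w) (δ u w) (a u w)) ⟩
    (∑[ w ∈ V ] (a z w - a z w * δ u w - a z w * a u w))
      ≡⟨ ∑-- (λ w → a z w - a z w * δ u w) (λ w → a z w * a u w) V ⟩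
    (∑[ w ∈ V ] (a z w - a z w * δ u w)) - (∑[ w ∈ V ] (a z w * a u w))
      ≡⟨ cong₂ _-_ (∑-- (a z) (λ w → a z w * δ u w) V) (∑-a-a zu) ⟩
    ∑ V (a z) - (∑[ w ∈ V ] (a z w * δ u w)) - + l
      ≡⟨ cong₂ (λ p q → p - q - + l) (∑-a z) (trans (∑-δ (a z) u) (χ-yes (adj? z u) zu)) ⟩
    κ  ∎
    where
    lem : ∀ p d q → p * (1ℤ - d - q) ≡ p - p * d - p * q
    lem = solve-∀

  -- A vertex outside `D` is adjacent to e of the s + 1 vertices of `D`, which leaves σ
  -- non-neighbours there; a vertex of `D` has none.
  ∑-ι-ν : ∀ {D} → IsBlock D → ∀ w → (∑[ u ∈ V ] (ι D u * ν u w)) ≡ σ - ι D w * σ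
  ∑-ι-ν {D} D-block w = begin
    (∑[ u ∈ V ] (ι D u * ν u w))
      ≡⟨ ∑-cong V (λ u → trans (cong (ι D u *_) (ν-sym u w)) (lem (ι D u) (δ w u) (a w u))) ⟩
    (∑[ u ∈ V ] (ι D u - ι D u * δ w u - ι D u * a w u))
      ≡⟨ ∑-- (λ u → ι D u - ι D u * δ w u) (λ u → ι D u * a w u) V ⟩
    (∑[ u ∈ V ] (ι D u - ι D u * δ w u)) - nb D w
      ≡⟨ cong₂ _-_ (∑-- (ι D) (λ u → ι D u * δ w u) V) (nb-block D-block w) ⟩
    ∑ V (ι D) - (∑[ u ∈ V ] (ι D u * δ w u)) - (+ e + ι D w * (+ s - + e))
      ≡⟨ cong₂ (λ p q → p - q - (+ e + ι D w * (+ s - + e)))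
           (trans (sym (∣∣-∑ D)) (cong +_ (proj₂ D-block))) (∑-δ (ι D) w) ⟩
    1ℤ + + s - ι D w - (+ e + ι D w * (+ s - + e))
      ≡⟨ lem′ (+ s) (+ e) (ι D w) ⟩
    σ - ι D w * σ  ∎
    where
    lem : ∀ p d q → p * (1ℤ - d - q) ≡ p - p * d - p * q
    lem = solve-∀
    lem′ : ∀ s e i → 1ℤ + s - i - (e + i * (s - e)) ≡ (1ℤ + s - e) - i * (1ℤ + s - e)
    lem′ = solve-∀

  -- Double counting of the pairs of non-adjacent neighbours u ∈ D, w ∉ D of z, weighted by h u = h w.
  weight-in-block : ∀ {z D} (h : Fin v → ℤ) →
    (∀ u w → Adj z u → Adj z w → u ≢ w → ¬ Adj u w → h u ≡ h w) →
    IsBlock D → z Subset.∈ D →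
    (∑[ w ∈ V ] (a z w * h w * ι D w)) * M ≡ (∑[ w ∈ V ] (a z w * h w)) * σ
  weight-in-block {z} {D} h h-const D-block@(clique , _) z∈D = begin
    H-in * (κ + σ)                 ≡⟨ *-distribˡ-+ H-in κ σ ⟩
    H-in * κ + H-in * σ            ≡⟨ cong (_+ H-in * σ) by-u ⟨
    pairs + H-in * σ               ≡⟨ cong (_+ H-in * σ) by-w ⟩
    H * σ - H-in * σ + H-in * σ    ≡⟨ lem (H * σ) (H-in * σ) ⟩
    H * σ                          ∎
    where
    lem : ∀ p q → p - q + q ≡ p
    lem = solve-∀
    H = ∑[ w ∈ V ] (a z w * h w)
    H-in = ∑[ w ∈ V ] (a z w * h w * ι D w)
    pairs = ∑[ u ∈ V ] (ι D u * a z u * (∑[ w ∈ V ] (a z w * h w * ν u w)))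

    -- The factor `ν u w` vanishes unless `u` and `w` are distinct and non-adjacent, and then
    -- `h-const` applies.
    transport : ∀ {u} → Adj z u → ∀ w → a z w * h w * ν u w ≡ h u * (a z w * ν u w)
    transport {u} zu w with ν-cases u w
    ... | inj₁ ν≡0 rewrite ν≡0 = trans (*-zeroʳ (a z w * h w))
      (sym (trans (cong (h u *_) (*-zeroʳ (a z w))) (*-zeroʳ (h u))))
    ... | inj₂ (u≢w , ¬uw) = trans
      (cong (_* ν u w) (χ-*-cong (adj? z w) λ zw → sym (h-const u w zu zw u≢w ¬uw)))
      (comm (a z w) (h u) (ν u w))
      where
      comm : ∀ p q r → p * q * r ≡ q * (p * r)
      comm = solve-∀

    -- Each `u` has κ partners `w` in N(z), all of weight `h u`.
    by-u : pairs ≡ H-in * κ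
    by-u = begin
      pairs                                             ≡⟨ ∑-cong V row ⟩
      (∑[ u ∈ V ] (a z u * h u * ι D u * κ))            ≡⟨ ∑-*ʳ κ (λ u → a z u * h u * ι D u) V ⟩
      H-in * κ                                          ∎
      where
      shuffle : ∀ i p q r → i * (p * (q * r)) ≡ p * q * i * r
      shuffle = solve-∀
      row : ∀ u → ι D u * a z u * (∑[ w ∈ V ] (a z w * h w * ν u w)) ≡ a z u * h u * ι D u * κ
      row u = begin
        ι D u * a z u * (∑[ w ∈ V ] (a z w * h w * ν u w))
          ≡⟨ *-assoc (ι D u) (a z u) _ ⟩
        ι D u * (a z u * (∑[ w ∈ V ] (a z w * h w * ν u w)))
          ≡⟨ cong (ι D u *_) (χ-*-cong (adj? z u) λ zu → trans (∑-cong V (transport zu))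
               (trans (∑-*ˡ (h u) (λ w → a z w * ν u w) V) (cong (h u *_) (∑-a-ν zu)))) ⟩
        ι D u * (a z u * (h u * κ))
          ≡⟨ shuffle (ι D u) (a z u) (h u) κ ⟩
        a z u * h u * ι D u * κ  ∎

    column : ∀ {w} → Adj z w → (∑[ u ∈ V ] (ι D u * a z u * ν u w)) ≡ σ - ι D w * σ
    column {w} zw = begin
      (∑[ u ∈ V ] (ι D u * a z u * ν u w))
        ≡⟨ ∑-cong V (λ u → trans (cong (_* ν u w) (clique-a clique z∈D u))
             (lem′ (ι D u) (δ z u) (ν u w))) ⟩
      (∑[ u ∈ V ] (ι D u * ν u w - ι D u * ν u w * δ z u))
        ≡⟨ ∑-- (λ u → ι D u * ν u w) (λ u → ι D u * ν u w * δ z u) V ⟩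
      (∑[ u ∈ V ] (ι D u * ν u w)) - (∑[ u ∈ V ] (ι D u * ν u w * δ z u))
        ≡⟨ cong₂ _-_ (∑-ι-ν D-block w) (∑-δ (λ u → ι D u * ν u w) z) ⟩
      σ - ι D w * σ - ι D z * ν z w
        -- `z` is the only vertex of `D` outside N(z); being adjacent to `w`, it contributes
        -- nothing.
        ≡⟨ cong (_-_ (σ - ι D w * σ)) (trans (cong (ι D z *_) (ν-adj zw)) (*-zeroʳ (ι D z))) ⟩
      σ - ι D w * σ - 0ℤ
        ≡⟨ +-identityʳ _ ⟩
      σ - ι D w * σ  ∎
      where
      lem′ : ∀ i d n → (i - i * d) * n ≡ i * n - i * n * d
      lem′ = solve-∀

    -- Each `w` outside `D` has σ partners `u`. A `w` in `D` has none, which gives the subtracted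
    -- term.
    by-w : pairs ≡ H * σ - H-in * σ
    by-w = begin
      pairs
        ≡⟨ ∑-exchange (λ u → ι D u * a z u) (λ w → a z w * h w) ν V V ⟩
      (∑[ w ∈ V ] (a z w * h w * (∑[ u ∈ V ] (ι D u * a z u * ν u w))))
        ≡⟨ ∑-cong V (λ w → trans (swap (a z w) (h w) _)
             (trans (χ-*-cong (adj? z w) (λ zw → cong (_* h w) (column zw)))
                    (shuffle (a z w) (h w) (ι D w) σ))) ⟩
      (∑[ w ∈ V ] (a z w * h w * σ - a z w * h w * ι D w * σ))
        ≡⟨ ∑-- (λ w → a z w * h w * σ) (λ w → a z w * h w * ι D w * σ) V ⟩
      (∑[ w ∈ V ] (a z w * h w * σ)) - (∑[ w ∈ V ] (a z w * h w * ι D w * σ))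
        ≡⟨ cong₂ _-_ (∑-*ʳ σ (λ w → a z w * h w) V) (∑-*ʳ σ (λ w → a z w * h w * ι D w) V) ⟩
      H * σ - H-in * σ  ∎
      where
      swap : ∀ p q r → p * q * r ≡ p * (r * q)
      swap = solve-∀
      shuffle : ∀ p q i r → p * ((r - i * r) * q) ≡ p * q * r - p * q * i * r
      shuffle = solve-∀

  -- Here `h` is the indicator of the level set of `c₂ z` on N(z) through `w₀`. Summing
  -- `weight-in-block` over the blocks through `z` counts each of its H members `c₂ z w₀` times; H
  -- is not 0, as `w₀` is a member, and cancels.
  c₂-adj : ∀ {z w} → Adj z w → c₂ z w * M ≡ c₁ z * σ
  c₂-adj {z} {w₀} zw₀ = *-cancelˡ-≢0 H H≢0 (begin
    H * (c₂ z w₀ * M)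
      ≡⟨ *-assoc H (c₂ z w₀) M ⟨
    H * c₂ z w₀ * M
      ≡⟨ cong (_* M) (∑-*ʳ (c₂ z w₀) (λ w → a z w * h w) V) ⟨
    (∑[ w ∈ V ] (a z w * h w * c₂ z w₀)) * M
      ≡⟨ cong (_* M) (∑-cong V λ w → trans (*-assoc (a z w) (h w) _)
           (trans (cong (a z w *_) (χ-*-cong (same? w) sym)) (sym (*-assoc (a z w) (h w) _)))) ⟩
    (∑[ w ∈ V ] (a z w * h w * c₂ z w)) * M
      ≡⟨ cong (_* M) (∑-exchange (λ w → a z w * h w) (λ D → ι D z) (λ w D → ι D w) V blocks) ⟩
    (∑[ D ∈ blocks ] (ι D z * (∑[ w ∈ V ] (a z w * h w * ι D w)))) * M
      ≡⟨ ∑-*ʳ M (λ D → ι D z * (∑[ w ∈ V ] (a z w * h w * ι D w))) blocks ⟨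
    (∑[ D ∈ blocks ] (ι D z * (∑[ w ∈ V ] (a z w * h w * ι D w)) * M))
      ≡⟨ ∑-cong-∈ blocks (λ {D} D∈ → trans (*-assoc (ι D z) _ M)
           (χ-*-cong (z ∈? D) λ z∈D → weight-in-block h h-const (∈-blocks⁻ D∈) z∈D)) ⟩
    (∑[ D ∈ blocks ] (ι D z * (H * σ)))
      ≡⟨ ∑-*ʳ (H * σ) (λ D → ι D z) blocks ⟩
    c₁ z * (H * σ)
      ≡⟨ comm (c₁ z) H σ ⟩
    H * (c₁ z * σ)  ∎)
    where
    comm : ∀ p q r → p * (q * r) ≡ q * (p * r)
    comm = solve-∀
    same? : ∀ w → Dec (c₂ z w ≡ c₂ z w₀)
    same? w = c₂ z w ℤ.≟ c₂ z w₀
    h : Fin v → ℤ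
    h w = χ (same? w)
    H = ∑[ w ∈ V ] (a z w * h w)
    h-const : ∀ u w → Adj z u → Adj z w → u ≢ w → ¬ Adj u w → h u ≡ h w
    h-const u w zu zw u≢w ¬uw = χ-⇔ (same? u) (same? w) (trans (sym eq)) (trans eq)
      where
      eq : c₂ z u ≡ c₂ z w
      eq = trans (c₂-sym z u) (trans (c₂-nonadj u≢w ¬uw (adj-sym zu) (adj-sym zw)) (c₂-sym w z))
    H≢0 : H ≢ 0ℤ
    H≢0 H≡0 = contradiction (begin
      1ℤ             ≡⟨ cong₂ _*_ (χ-yes (adj? z w₀) zw₀) (χ-yes (same? w₀) refl) ⟨
      a z w₀ * h w₀  ≡⟨ ∑≡0⇒≡0 (λ w → 0≤-* (0≤χ (adj? z w)) (0≤χ (same? w))) H≡0 (∈-allFin w₀) ⟩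
      0ℤ             ∎) λ ()

  -- By `c₂-adj` and the symmetry of `c₂`, the value 0 of `c₁` spreads along edges. So if `x` were
  -- in no block, none of its neighbours would be in `C`, although `x` has e > 0 neighbours there.
  c₁-≢0 : ∀ {C} → IsBlock C → + e ≢ 0ℤ → σ ≢ 0ℤ → ∀ x → c₁ x ≢ 0ℤ
  c₁-≢0 {C} C-block@(clique , size) e≢0 σ≢0 x c₁x≡0 = e≢0 (begin
    + e                           ≡⟨ nexus clique size x (c₁≡0⇒∉ x c₁x≡0) ⟨
    (∑[ w ∈ V ] (ι C w * a x w))  ≡⟨ ∑-cong V term ⟩
    (∑[ w ∈ V ] 0ℤ)               ≡⟨ ∑-zero V ⟩
    0ℤ                            ∎)
    where
    c₁≡0⇒∉ : ∀ y → c₁ y ≡ 0ℤ → y Subset.∉ C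
    c₁≡0⇒∉ y c₁≡0 y∈C = contradiction
      (trans (sym (χ-yes (y ∈? C) y∈C))
             (∑≡0⇒≡0 (λ D → 0≤χ (y ∈? D)) c₁≡0 (∈-blocks⁺ C-block))) λ ()

    neighbour : ∀ w → Adj x w → c₁ w ≡ 0ℤ
    neighbour w xw = [ id , (λ σ≡0 → contradiction σ≡0 σ≢0) ]′ (i*j≡0⇒i≡0∨j≡0 (c₁ w) {σ} (begin
      c₁ w * σ    ≡⟨ c₂-adj (adj-sym xw) ⟨
      c₂ w x * M  ≡⟨ cong (_* M) (c₂-sym w x) ⟩
      c₂ x w * M  ≡⟨ c₂-adj xw ⟩
      c₁ x * σ    ≡⟨ cong (_* σ) c₁x≡0 ⟩
      0ℤ          ∎))

    term : ∀ w → ι C w * a x w ≡ 0ℤ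
    term w = begin
      ι C w * a x w  ≡⟨ *-comm (ι C w) (a x w) ⟩
      a x w * ι C w  ≡⟨ χ-*-cong (adj? x w) (λ xw → χ-no (w ∈? C) (c₁≡0⇒∉ w (neighbour w xw))) ⟩
      a x w * 0ℤ     ≡⟨ *-zeroʳ (a x w) ⟩
      0ℤ             ∎

  -- Counts the pairs of a block `D` through `x` and a neighbour `z` of `y` in `D`. Each block gives
  -- e of them, and each common neighbour `z` gives `c₂ x z`, which `c₂-adj` expresses through
  -- `c₁ x`.
  commonNbrs-nonadj : ∀ {x y} → c₁ x ≢ 0ℤ → x ≢ y → ¬ Adj x y → + commonNbrs G x y * σ ≡ + e * M
  commonNbrs-nonadj {x} {y} c₁≢0 x≢y ¬xy = *-cancelˡ-≢0 (c₁ x) c₁≢0 (begin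
    c₁ x * (+ commonNbrs G x y * σ)
      ≡⟨ comm (c₁ x) (+ commonNbrs G x y) σ ⟩
    + commonNbrs G x y * (c₁ x * σ)
      ≡⟨ cong (_* (c₁ x * σ)) (commonNbrs-∑ x y) ⟩
    (∑[ z ∈ V ] (a x z * a y z)) * (c₁ x * σ)
      ≡⟨ ∑-*ʳ (c₁ x * σ) (λ z → a x z * a y z) V ⟨
    (∑[ z ∈ V ] (a x z * a y z * (c₁ x * σ)))
      ≡⟨ ∑-cong V (λ z → begin
           a x z * a y z * (c₁ x * σ)    ≡⟨ *-assoc (a x z) (a y z) (c₁ x * σ) ⟩
           a x z * (a y z * (c₁ x * σ))
             ≡⟨ χ-*-cong (adj? x z) (λ xz → cong (a y z *_) (sym (c₂-adj xz))) ⟩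
           a x z * (a y z * (c₂ x z * M))  ≡⟨ shuffle (a x z) (a y z) (c₂ x z) M ⟩
           a y z * (a x z * c₂ x z) * M  ≡⟨ cong (_* M) (drop-a z) ⟩
           a y z * c₂ x z * M            ∎) ⟩
    (∑[ z ∈ V ] (a y z * c₂ x z * M))
      ≡⟨ ∑-*ʳ M (λ z → a y z * c₂ x z) V ⟩
    (∑[ z ∈ V ] (a y z * c₂ x z)) * M
      ≡⟨ cong (_* M) (∑-exchange (a y) (λ D → ι D x) (λ z D → ι D z) V blocks) ⟩
    (∑[ D ∈ blocks ] (ι D x * (∑[ z ∈ V ] (a y z * ι D z)))) * M
      ≡⟨ cong (_* M) (∑-cong-∈ blocks λ {D} D∈ → χ-*-cong (x ∈? D) λ x∈D →
           let clique , size = ∈-blocks⁻ D∈ in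
           trans (∑-cong V λ z → *-comm (a y z) (ι D z))
                 (nexus clique size y (nonadj⇒∉ clique x≢y ¬xy x∈D))) ⟩
    (∑[ D ∈ blocks ] (ι D x * + e)) * M
      ≡⟨ cong (_* M) (∑-*ʳ (+ e) (λ D → ι D x) blocks) ⟩
    c₁ x * + e * M
      ≡⟨ *-assoc (c₁ x) (+ e) M ⟩
    c₁ x * (+ e * M)  ∎)
    where
    comm : ∀ p q r → p * (q * r) ≡ q * (p * r)
    comm = solve-∀
    shuffle : ∀ p q c m → p * (q * (c * m)) ≡ q * (p * c) * m
    shuffle = solve-∀

    c₂≡0 : ∀ {z} → x ≢ z → ¬ Adj x z → c₂ x z ≡ 0ℤ
    c₂≡0 {z} x≢z ¬xz = trans (∑-cong-∈ blocks λ {D} D∈ → trans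
      (χ-*-cong (x ∈? D) λ x∈D → χ-no (z ∈? D) (nonadj⇒∉ (proj₁ (∈-blocks⁻ D∈)) x≢z ¬xz x∈D))
      (*-zeroʳ (ι D x))) (∑-zero blocks)

    -- A block through `x` and `z` makes them equal or adjacent, and they differ because `z` is
    -- adjacent to `y` while `x` is not.
    drop-a : ∀ z → a y z * (a x z * c₂ x z) ≡ a y z * c₂ x z
    drop-a z = χ-*-cong (adj? y z) λ yz →
      [ (λ xz → trans (cong (_* c₂ x z) (χ-yes (adj? x z) xz)) (*-identityˡ (c₂ x z)))
      , (λ ¬xz → let c₂≡0′ = c₂≡0 {z} (λ { refl → ¬xy (adj-sym yz) }) ¬xz in
          trans (cong (a x z *_) c₂≡0′) (trans (*-zeroʳ (a x z)) (sym c₂≡0′)))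
      ]′ (toSum (adj? x z))

-- The parameters of a regular clique

-- Eliminates the nexus m. In F the coefficient of m is n - 1 - k and in the first equation it is v
-- - n, so cross-multiplying by these cancels m.
nexus-quadratic : ∀ v k l m n → n ≢ 0ℤ →
  v * m + n * (n - 1ℤ - m) ≡ n * k →
  n * (n * l + (k - l)) - + 2 * m * (n * k) + (v * (m * m) + n * - ((n - 1ℤ - m) * (n - 1ℤ - m))) ≡ 0ℤ →
  (v + l - + 2 * k) * ((n - 1ℤ) * (n - 1ℤ)) + (k * k - k + l - v * l) * (n - 1ℤ) ≡ k * (v - 1ℤ - k)
nexus-quadratic v k l m n n≢0 eq₁ eq₂ = sym (i-j≡0⇒i≡j _ _ (begin
  k * (v - 1ℤ - k) - ((v + l - + 2 * k) * ((n - 1ℤ) * (n - 1ℤ)) + (k * k - k + l - v * l) * (n - 1ℤ))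
    ≡⟨ lem v k l m n ⟩
  (v - n) * F - (n - 1ℤ - k) * (v * m + n * (n - 1ℤ - m) - n * k)
    ≡⟨ cong₂ (λ p q → (v - n) * p - (n - 1ℤ - k) * q) F≡0 (i≡j⇒i-j≡0 eq₁) ⟩
  (v - n) * 0ℤ - (n - 1ℤ - k) * 0ℤ
    ≡⟨ cong₂ _-_ (*-zeroʳ (v - n)) (*-zeroʳ (n - 1ℤ - k)) ⟩
  0ℤ  ∎))
  where
  -- For a clique of order n with nexus m, F = 0 equates two counts of the walks of length 2 from a
  -- clique vertex back into the clique.
  F = k + (n - 1ℤ) * l - m * k - (n - 1ℤ) * (n - 1ℤ - m)
  lem : ∀ v k l m n →
    k * (v - 1ℤ - k) - ((v + l - + 2 * k) * ((n - 1ℤ) * (n - 1ℤ)) + (k * k - k + l - v * l) * (n - 1ℤ)) ≡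
    (v - n) * (k + (n - 1ℤ) * l - m * k - (n - 1ℤ) * (n - 1ℤ - m)) -
      (n - 1ℤ - k) * (v * m + n * (n - 1ℤ - m) - n * k)
  lem = solve-∀
  lem′ : ∀ v k l m n →
    n * (k + (n - 1ℤ) * l - m * k - (n - 1ℤ) * (n - 1ℤ - m)) ≡
    n * (n * l + (k - l)) - + 2 * m * (n * k) + (v * (m * m) + n * - ((n - 1ℤ - m) * (n - 1ℤ - m))) -
      m * (v * m + n * (n - 1ℤ - m) - n * k)
  lem′ = solve-∀
  F≡0 : F ≡ 0ℤ
  F≡0 = *-cancelˡ-≢0 n n≢0 (begin
    n * F         ≡⟨ lem′ v k l m n ⟩
    n * (n * l + (k - l)) - + 2 * m * (n * k) + (v * (m * m) + n * - ((n - 1ℤ - m) * (n - 1ℤ - m))) -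
      m * (v * m + n * (n - 1ℤ - m) - n * k)
                  ≡⟨ cong₂ (λ p q → p - m * q) eq₂ (i≡j⇒i-j≡0 eq₁) ⟩
    0ℤ - m * 0ℤ   ≡⟨ cong (_-_ 0ℤ) (*-zeroʳ m) ⟩
    0ℤ            ≡⟨ *-zeroʳ n ⟨
    n * 0ℤ        ∎)

-- Undoes the completion of the square, which had multiplied the equation by 4a.
discriminant-root : ∀ a b c s → a ≢ 0ℤ →
  (+ 2 * a * s + b) * (+ 2 * a * s + b) ≡ b * b + + 4 * a * c → a * (s * s) + b * s ≡ c
discriminant-root a b c s a≢0 eq = *-cancelˡ-≢0 (+ 4 * a) 4a≢0 (begin
  + 4 * a * (a * (s * s) + b * s)                     ≡⟨ lem a b s ⟩
  (+ 2 * a * s + b) * (+ 2 * a * s + b) - b * b       ≡⟨ cong (_- b * b) eq ⟩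
  b * b + + 4 * a * c - b * b                         ≡⟨ lem′ (b * b) (+ 4 * a * c) ⟩
  + 4 * a * c                                         ∎)
  where
  lem : ∀ a b s → + 4 * a * (a * (s * s) + b * s) ≡ (+ 2 * a * s + b) * (+ 2 * a * s + b) - b * b
  lem = solve-∀
  lem′ : ∀ p q → p + q - p ≡ q
  lem′ = solve-∀
  4a≢0 : + 4 * a ≢ 0ℤ
  4a≢0 eq₀ with i*j≡0⇒i≡0∨j≡0 (+ 4) eq₀
  ... | inj₂ a≡0 = a≢0 a≡0

-- Two distinct roots s and t would satisfy a s t = - c < 0.
nonneg-root-unique : ∀ {a b c s t} → 0ℤ ≤ a → 0ℤ ≤ c → c ≢ 0ℤ → 0ℤ ≤ s → 0ℤ ≤ t →
  a * (s * s) + b * s ≡ c → a * (t * t) + b * t ≡ c → s ≡ t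
nonneg-root-unique {a} {b} {c} {s} {t} 0≤a 0≤c c≢0 0≤s 0≤t s-root t-root
  with i*j≡0⇒i≡0∨j≡0 (s - t) (trans (lem a b s t) (i≡j⇒i-j≡0 (trans s-root (sym t-root))))
  where
  lem : ∀ a b s t → (s - t) * (a * (s + t) + b) ≡ (a * (s * s) + b * s) - (a * (t * t) + b * t)
  lem = solve-∀
... | inj₁ s-t≡0 = i-j≡0⇒i≡j s t s-t≡0
... | inj₂ sum≡0 = contradiction (proj₁ (0≤∧0≤∧+≡0⇒≡0 0≤c (0≤-* 0≤a (0≤-* 0≤s 0≤t)) (begin
  c + a * (s * t)                      ≡⟨ cong (_+ a * (s * t)) s-root ⟨
  a * (s * s) + b * s + a * (s * t)    ≡⟨ lem a b s t ⟩
  s * (a * (s + t) + b)                ≡⟨ cong (s *_) sum≡0 ⟩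
  s * 0ℤ                               ≡⟨ *-zeroʳ s ⟩
  0ℤ                                   ∎))) c≢0
  where
  lem : ∀ a b s t → a * (s * s) + b * s + a * (s * t) ≡ s * (a * (s + t) + b)
  lem = solve-∀

-- Non-adjacent pairs and complete multipartite graphs

nonadjacent-pair : ∀ {v} (G : Graph v) → ¬ IsComplete G → ∃[ x ] ∃[ y ] x ≢ y × ¬ Graph.Adj G x y
nonadjacent-pair G ¬complete =
  decidable-stable (any? λ x → any? λ y → ¬? (x ≟ y) ×-dec ¬? (adj? x y)) λ none →
    ¬complete λ x y x≢y → decidable-stable (adj? x y) λ ¬xy → none (x , y , x≢y , ¬xy)
  where open Graph G

multipartite-commonNbrs : ∀ {v k l n} (G : Graph v) → IsEdgeRegular G k l →
  IsCompleteMultipartiteWith G n → ∀ x y → x ≢ y → ¬ Graph.Adj G x y → commonNbrs G x y ≡ k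
multipartite-commonNbrs {v} {k} {l} {n} G er (part , _ , adj⇔) x y x≢y ¬xy = +-injective (begin
  + commonNbrs G x y               ≡⟨ commonNbrs-∑ x y ⟩
  (∑[ z ∈ V ] (a x z * a y z))     ≡⟨ ∑-cong V (λ z → trans
                                        (χ-*-cong (adj? x z) λ xz → χ-yes (adj? y z) (transfer xz))
                                        (*-identityʳ (a x z))) ⟩
  ∑ V (a x)                        ≡⟨ ∑-a x ⟩
  + k                              ∎)
  where
  open Counting G
  open EdgeRegular G er
  same-part : part x ≡ part y
  same-part = decidable-stable (part x ≟ part y) (¬xy ∘ Equivalence.from (adj⇔ x y x≢y))
  transfer : ∀ {z} → Adj x z → Adj y z
  transfer {z} xz = Equivalence.from (adj⇔ y z λ { refl → ¬xy xz })
    (subst (_≢ part z) same-part (Equivalence.to (adj⇔ x z λ { refl → irrefl xz }) xz))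

-- Order and nexus of the given clique

module RegularClique {v k l s e : ℕ} (G : Graph v) (k≥1 : k ≥ 1) (er : IsEdgeRegular G k l)
  {x₀ y₀ : Fin v} (x₀≢y₀ : x₀ ≢ y₀) (¬x₀y₀ : ¬ Graph.Adj G x₀ y₀)
  {C : Subset v} (C-clique : IsClique G C) {m : ℕ} (m≥1 : m ≥ 1)
  (C-nexus : ∀ x → x Subset.∉ C → nbrsIn G x C ≡ m)
  (a≢0 : coefA v k l ≢ 0ℤ)
  (s-root : (+ 2 * coefA v k l * + s + coefB v k l) * (+ 2 * coefA v k l * + s + coefB v k l) ≡
    discr v k l)
  (e-def : IsParamE v k s e)
  where
  open Counting G
  open EdgeRegular G er

  nb-C : ∀ x → x Subset.∉ C → nb C x ≡ + m
  nb-C x x∉C = trans (sym (nbrsIn-∑ x C)) (cong +_ (C-nexus x x∉C))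

  m≢0 : + m ≢ 0ℤ
  m≢0 m≡0 = contradiction (+-injective m≡0) (ℕₚ.>⇒≢ m≥1)

  k≢0 : + k ≢ 0ℤ
  k≢0 k≡0 = contradiction (+-injective k≡0) (ℕₚ.>⇒≢ k≥1)

  -- If `C` were empty, `x₀` would be outside it with no neighbour in it, against m ≥ 1.
  ∣C∣≢0 : + ∣ C ∣ ≢ 0ℤ
  ∣C∣≢0 ∣C∣≡0 = m≢0 (begin
    + m                             ≡⟨ nb-C x₀ x₀∉C ⟨
    (∑[ w ∈ V ] (ι C w * a x₀ w))   ≡⟨ ∑-cong V (λ w → cong (_* a x₀ w) (ι≡0 w)) ⟩
    (∑[ w ∈ V ] 0ℤ)                 ≡⟨ ∑-zero V ⟩
    0ℤ                              ∎)
    where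
    ι≡0 : ∀ w → ι C w ≡ 0ℤ
    ι≡0 w = ∑≡0⇒≡0 (λ u → 0≤χ (u ∈? C)) (trans (sym (∣∣-∑ C)) ∣C∣≡0) (∈-allFin w)
    x₀∉C : x₀ Subset.∉ C
    x₀∉C x₀∈C = contradiction (trans (sym (χ-yes (x₀ ∈? C) x₀∈C)) (ι≡0 x₀)) λ ()

  -- Supplies the edge at which `0≤v+l-2k` is applied.
  x₀-neighbour : ∃[ y ] Adj x₀ y
  x₀-neighbour = decidable-stable (any? (adj? x₀)) λ none → k≢0
    (trans (sym (∑-a x₀)) (∑χ≡0 (adj? x₀) V λ {y} _ x₀y → none (y , x₀y)))

  0≤v-1-k : 0ℤ ≤ + v - 1ℤ - + k
  0≤v-1-k = subst (0ℤ ≤_) (∑-ν x₀) (0≤-∑ V (0≤ν x₀))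

  -- The number v - 1 - k counts the vertices distinct from and not adjacent to `x₀`, among them
  -- `y₀`.
  v-1-k≢0 : + v - 1ℤ - + k ≢ 0ℤ
  v-1-k≢0 eq = contradiction
    (trans (sym (ν-nonadj x₀≢y₀ ¬x₀y₀)) (∑≡0⇒≡0 (0≤ν x₀) (trans (∑-ν x₀) eq) (∈-allFin y₀))) λ ()

  -- Both are non-negative roots t of a t² + b t = k (v - 1 - k): s by its definition, the other by
  -- `nexus-quadratic`. As a ≥ 0 and the right side is positive, only one such root exists.
  s≡∣C∣-1 : + s ≡ + ∣ C ∣ - 1ℤ
  s≡∣C∣-1 = nonneg-root-unique
    {a = coefA v k l} {coefB v k l} {+ k * (+ v - 1ℤ - + k)} {+ s} {+ ∣ C ∣ - 1ℤ}
    (0≤v+l-2k (proj₂ x₀-neighbour))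
    (0≤-* {+ k} (+≤+ z≤n) 0≤v-1-k)
    c≢0
    (+≤+ z≤n)
    (pred-nonneg ∣ C ∣ ∣C∣≢0)
    (discriminant-root (coefA v k l) (coefB v k l) (+ k * (+ v - 1ℤ - + k)) (+ s) a≢0
      (trans s-root (cong (_+_ (coefB v k l * coefB v k l)) (lem (+ v) (+ k) (+ l)))))
    (nexus-quadratic (+ v) (+ k) (+ l) (+ m) (+ ∣ C ∣) ∣C∣≢0
      (∑-nexus C-clique nb-C)
      (trans (sym (deviation-formula C-clique (+ m))) (nexus⇒deviation≡0 C-clique nb-C)))
    where
    lem : ∀ v k l → + 4 * k * (v - k - 1ℤ) * (v + l - + 2 * k) ≡
      + 4 * (v + l - + 2 * k) * (k * (v - 1ℤ - k))
    lem = solve-∀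
    c≢0 : + k * (+ v - 1ℤ - + k) ≢ 0ℤ
    c≢0 eq with i*j≡0⇒i≡0∨j≡0 (+ k) eq
    ... | inj₁ k≡0 = k≢0 k≡0
    ... | inj₂ p   = v-1-k≢0 p
    pred-nonneg : ∀ n → + n ≢ 0ℤ → 0ℤ ≤ + n - 1ℤ
    pred-nonneg ℕ.zero  ≢0 = contradiction refl ≢0
    pred-nonneg (suc n) _  = +≤+ z≤n

  ∣C∣≡1+s : ∣ C ∣ ≡ suc s
  ∣C∣≡1+s = +-injective (begin
    + ∣ C ∣                  ≡⟨ lem (+ ∣ C ∣) ⟩
    1ℤ + (+ ∣ C ∣ - 1ℤ)      ≡⟨ cong (_+_ 1ℤ) s≡∣C∣-1 ⟨
    + suc s                  ∎)
    where
    lem : ∀ n → n ≡ 1ℤ + (n - 1ℤ)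
    lem = solve-∀

  -- Counting the edges between `C` and its complement shows that m satisfies the linear equation
  -- that defines e.
  m≡e : + m ≡ + e
  m≡e = *-cancelˡ-≢0 (+ v - + suc s) (proj₁ e-def) (begin
    (+ v - + suc s) * + m
      ≡⟨ lem (+ v) (1ℤ + + s) (+ m) ⟩
    + v * + m + + suc s * (+ suc s - 1ℤ - + m) - + suc s * (+ suc s - 1ℤ)
      ≡⟨ cong (_- + suc s * (+ suc s - 1ℤ)) (subst (λ n → + v * + m + + n * (+ n - 1ℤ - + m) ≡ + n * + k)
           ∣C∣≡1+s (∑-nexus C-clique nb-C)) ⟩
    + suc s * + k - + suc s * + s
      ≡⟨ lem′ (+ suc s) (+ k) (+ s) ⟩
    + suc s * (+ k - + s)
      ≡⟨ proj₂ e-def ⟨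
    + e * (+ v - + suc s)
      ≡⟨ *-comm (+ e) (+ v - + suc s) ⟩
    (+ v - + suc s) * + e  ∎)
    where
    lem : ∀ v n m → (v - n) * m ≡ v * m + n * (n - 1ℤ - m) - n * (n - 1ℤ)
    lem = solve-∀
    lem′ : ∀ n k s → n * k - n * s ≡ n * (k - s)
    lem′ = solve-∀

  nexus : ∀ {D} → IsClique G D → ∣ D ∣ ≡ suc s → ∀ x → x Subset.∉ D → nb D x ≡ + e
  nexus {D} clique size = deviation≡0⇒nexus clique (begin
    deviation clique (+ e)    ≡⟨ deviation-formula clique (+ e) ⟩
    -- The formula depends on `D` only through its order, so the zero deviation of `C` carries over.
    formula ∣ D ∣             ≡⟨ cong formula (trans size (sym ∣C∣≡1+s)) ⟩
    formula ∣ C ∣             ≡⟨ deviation-formula C-clique (+ e) ⟨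
    deviation C-clique (+ e)  ≡⟨ nexus⇒deviation≡0 C-clique (λ x x∉C → trans (nb-C x x∉C) m≡e) ⟩
    0ℤ                        ∎)
    where
    formula : ℕ → ℤ
    formula n = + n * (+ n * + l + (+ k - + l)) - + 2 * + e * (+ n * + k)
      + (+ v * (+ e * + e) + + n * - ((+ n - 1ℤ - + e) * (+ n - 1ℤ - + e)))

  -- By the definition of e, (s + 1)(v - 1 - k) = (s + 1 - e)(v - s - 1), the number of non-adjacent
  -- pairs between `C` and its complement, and the left side is not 0.
  1+s-e≢0 : + suc s - + e ≢ 0ℤ
  1+s-e≢0 eq with i*j≡0⇒i≡0∨j≡0 (+ suc s) (begin
    + suc s * (+ v - 1ℤ - + k)
      ≡⟨ lem (+ v) (+ k) (+ s) ⟩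
    + suc s * (+ v - + suc s) - + suc s * (+ k - + s)
      ≡⟨ cong (_-_ (+ suc s * (+ v - + suc s))) (proj₂ e-def) ⟨
    + suc s * (+ v - + suc s) - + e * (+ v - + suc s)
      ≡⟨ lem′ (+ suc s) (+ e) (+ v - + suc s) ⟩
    (+ suc s - + e) * (+ v - + suc s)
      ≡⟨ cong (_* (+ v - + suc s)) eq ⟩
    0ℤ  ∎)
    where
    lem : ∀ v k s → (1ℤ + s) * (v - 1ℤ - k) ≡ (1ℤ + s) * (v - (1ℤ + s)) - (1ℤ + s) * (k - s)
    lem = solve-∀
    lem′ : ∀ p e q → p * q - e * q ≡ (p - e) * q
    lem′ = solve-∀
  ... | inj₂ p = v-1-k≢0 p

-- Strong regularity in the two cases of the definition of s

theorem2p1 : (v k λ' s e : ℕ) (G : Graph v) →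
    k ≥ 1 → IsNeumaier G k λ' → IsParamS G k λ' s → IsParamE v k s e →
    (∀ (C : Subset v) → IsClique G C → ∣ C ∣ ≡ suc e →
    Σ (Subset v) λ D → IsClique G D × ∣ D ∣ ≡ suc s × C ⊆ D) →
    IsStronglyRegular G
theorem2p1 v k λ' s e G k≥1 (_ , er@(regular , edge) , _) (inj₁ multipartite) e-def extend =
  k , λ' , k , regular , edge , multipartite-commonNbrs G er multipartite
theorem2p1 v k λ' s e G k≥1 (¬complete , er@(regular , edge) , C , C-clique , m , m≥1 , C-nexus)
  (inj₂ (_ , a≢0 , _ , s-root)) e-def extend with nonadjacent-pair G ¬complete
... | x₀ , y₀ , x₀≢y₀ , ¬x₀y₀ =
  -- The pair `x₀`, `y₀` supplies μ: for every non-adjacent pair the count times σ is e M, and σ is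
  -- not 0.
  k , λ' , commonNbrs G x₀ y₀ , regular , edge , λ x y x≢y ¬xy →
    +-injective (*-cancelˡ-≢0 σ 1+s-e≢0 (begin
      σ * + commonNbrs G x y    ≡⟨ *-comm σ (+ commonNbrs G x y) ⟩
      + commonNbrs G x y * σ    ≡⟨ commonNbrs-nonadj (c₁≢0 x) x≢y ¬xy ⟩
      + e * M                   ≡⟨ commonNbrs-nonadj (c₁≢0 x₀) x₀≢y₀ ¬x₀y₀ ⟨
      + commonNbrs G x₀ y₀ * σ  ≡⟨ *-comm (+ commonNbrs G x₀ y₀) σ ⟩
      σ * + commonNbrs G x₀ y₀  ∎))
  where
  open RegularClique {s = s} {e} G k≥1 er x₀≢y₀ ¬x₀y₀ C-clique m≥1 C-nexus a≢0 s-root e-def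
  open Blocks {s = s} {e} G er nexus extend
  c₁≢0 : ∀ x → c₁ x ≢ 0ℤ
  -- Here e is not 0 because it equals m ≥ 1.
  c₁≢0 = c₁-≢0 (C-clique , ∣C∣≡1+s) (λ e≡0 → m≢0 (trans m≡e e≡0)) 1+s-e≢0
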